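{- Let $G$ be a 2-walk-regular graph that is not bipartite and not complete multipartite. If $G$ is uniquely vector colorable, then $G$ is a core.
   Context: Let $A$ be the adjacency matrix of $G$ and $\circ$ the entrywise (Schur) product. $G$ is 1-walk-regular if for every $\ell\in\mathbb{N}$ there are constants $a_\ell,b_\ell$ with $A^\ell\circ I=a_\ell I$ and $A^\ell\circ A=b_\ell A$. $G$ is 2-walk-regular if it is 1-walk-regular and moreover for every $\ell\in\mathbb{N}$ there is a constant $c_\ell$ with $A^\ell\circ A_2=c_\ell A_2$, where $A_2$ is the adjacency matrix of the distance-2 graph of $G$ (vertices adjacent iff at distance exactly 2 in $G$). A vector $t$-coloring assigns unit vectors $p_i$ to vertices with $\langle p_i,p_j\rangle\le-1/(t-1)$ on edges; $\chi_v(G)$ is the least $t\ge2$ admitting one; $G$ is uniquely vector colorable if any two optimal (i.e. vector $\chi_v(G)$-) colorings have equal Gram matrices. $G$ is a core if every homomorphism $G\to G$ is an automorphism. -}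

module Defs where

open import Algebra.Bundles using (CommutativeRing)
open import Algebra.Core using (Op₁)
open import Data.Bool.Base using (if_then_else_)
open import Data.Fin.Base using (Fin)
open import Data.Fin.Properties using (_≟_; any?)
open import Data.Nat.Base as ℕ using (ℕ; zero; suc)
open import Data.Nat.Properties using (allUpTo?)
open import Data.Product.Base using (_×_; _,_; ∃; ∃-syntax; Σ-syntax)
open import Data.Vec.Functional using (Vector)
open import Function.Bundles using (_⇔_)
open import Function.Definitions using (Bijective)
open import Level using (Level; _⊔_; 0ℓ) renaming (suc to lsuc)
open import Relation.Binary.Core using (Rel; _Preserves_⟶_)
open import Relation.Binary.Definitions using (Symmetric; Decidable; Irreflexive)
open import Relation.Binary.PropositionalEquality using (_≡_; _≢_; refl; sym)
open import Relation.Binary.Structures using (IsDecTotalOrder)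
open import Relation.Nullary using (¬_; does)
open import Relation.Nullary.Decidable using (_×-dec_; ¬?)
open import Relation.Unary using (Pred)

-- The classical axioms of ℝ: a totally ordered field in which every nonempty
-- set bounded above has a least upper bound.  Classically ℝ is the only
-- model up to isomorphism, so a statement about an arbitrary model is a
-- statement about ℝ.  The order is decidable, as it is in classical analysis.

record CompleteOrderedField (c ℓ₁ ℓ₂ : Level) : Set (lsuc (c ⊔ ℓ₁ ⊔ ℓ₂)) where
  field
    commutativeRing : CommutativeRing c ℓ₁

  open CommutativeRing commutativeRing public

  infix 4 _≤_
  infix 8 _⁻¹

  field
    _≤_             : Rel Carrier ℓ₂
    isDecTotalOrder : IsDecTotalOrder _≈_ _≤_
    0≉1             : ¬ (0# ≈ 1#)

    -- The value of 0# ⁻¹ is left unspecified.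
    _⁻¹             : Op₁ Carrier
    ⁻¹-inverseʳ     : ∀ {x} → ¬ (x ≈ 0#) → x * x ⁻¹ ≈ 1#

    +-monoˡ-≤       : ∀ {x y} z → x ≤ y → x + z ≤ y + z
    *-nonNegative   : ∀ {x y} → 0# ≤ x → 0# ≤ y → 0# ≤ x * y

  IsUpperBound : ∀ {p} → Pred Carrier p → Carrier → Set (c ⊔ ℓ₂ ⊔ p)
  IsUpperBound P b = ∀ {x} → P x → x ≤ b

  IsLeastUpperBound : ∀ {p} → Pred Carrier p → Carrier → Set (c ⊔ ℓ₂ ⊔ p)
  IsLeastUpperBound P s = IsUpperBound P s × (∀ {b} → IsUpperBound P b → s ≤ b)

  field
    complete : (P : Pred Carrier (c ⊔ ℓ₁ ⊔ ℓ₂)) →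
               ∃ P → ∃ (IsUpperBound P) → ∃ (IsLeastUpperBound P)

record Graph (n : ℕ) : Set₁ where
  infix 4 _∼_ _∼?_
  field
    _∼_      : Rel (Fin n) 0ℓ
    ∼-sym    : Symmetric _∼_
    ∼-irrefl : Irreflexive _≡_ _∼_
    _∼?_     : Decidable _∼_

module _ {n : ℕ} (G : Graph n) where
  open Graph G

  Walk : ℕ → Rel (Fin n) 0ℓ
  Walk zero    u v = u ≡ v
  Walk (suc k) u v = ∃[ w ] (u ∼ w × Walk k w v)

  Distance : ℕ → Rel (Fin n) 0ℓ
  Distance k u v = Walk k u v × (∀ {j} → j ℕ.< k → ¬ Walk j u v)

  walk? : ∀ k → Decidable (Walk k)
  walk? zero    u v = u ≟ v
  walk? (suc k) u v = any? (λ w → (u ∼? w) ×-dec walk? k w v)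

  distance? : ∀ k → Decidable (Distance k)
  distance? k u v = walk? k u v ×-dec allUpTo? (λ j → ¬? (walk? j u v)) k

  walk-snoc : ∀ k {u v w} → Walk k u v → v ∼ w → Walk (suc k) u w
  walk-snoc zero    {w = w} refl        v∼w = w , v∼w , refl
  walk-snoc (suc k) (x , u∼x , x⇝v) v∼w = x , u∼x , walk-snoc k x⇝v v∼w

  walk-sym : ∀ k → Symmetric (Walk k)
  walk-sym zero    u≡v             = sym u≡v
  walk-sym (suc k) (w , u∼w , w⇝v) = walk-snoc k (walk-sym k w⇝v) (∼-sym u∼w)

  distance2Graph : Graph n
  distance2Graph = record
    { _∼_      = Distance 2
    ; ∼-sym    = λ { (p , shortest) →
                     walk-sym 2 p , λ {j} j<2 q → shortest j<2 (walk-sym j q) }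
    ; ∼-irrefl = λ { u≡v (_ , shortest) → shortest (ℕ.s≤s ℕ.z≤n) u≡v }
    ; _∼?_     = distance? 2
    }

  Bipartite : Set
  Bipartite = Σ[ f ∈ (Fin n → Fin 2) ] (∀ u v → u ∼ v → f u ≢ f v)

  -- f assigns to each vertex its part; the number of parts is arbitrary.
  CompleteMultipartite : Set
  CompleteMultipartite =
    ∃[ m ] Σ[ f ∈ (Fin n → Fin m) ] (∀ u v → u ∼ v ⇔ f u ≢ f v)

  IsEndomorphism : (Fin n → Fin n) → Set
  IsEndomorphism φ = φ Preserves _∼_ ⟶ _∼_

  IsAutomorphism : (Fin n → Fin n) → Set
  IsAutomorphism φ = Bijective _≡_ _≡_ φ × (∀ u v → u ∼ v ⇔ φ u ∼ φ v)

  Core : Set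
  Core = ∀ φ → IsEndomorphism φ → IsAutomorphism φ

module _ {c ℓ₁ ℓ₂ : Level} (ℝ : CompleteOrderedField c ℓ₁ ℓ₂) where
  open CompleteOrderedField ℝ hiding (refl; sym; zero)
  open import Algebra.Properties.Monoid.Sum +-monoid using (sum)

  Matrix : ℕ → Set c
  Matrix n = Fin n → Fin n → Carrier

  module _ {n : ℕ} where
    infix  4 _≋_
    infixl 7 _·_ _⊙_ _∘ₛ_
    infixr 8 _^_

    _≋_ : Rel (Matrix n) ℓ₁
    M ≋ N = ∀ i j → M i j ≈ N i j

    identity : Matrix n
    identity i j = if does (i ≟ j) then 1# else 0#

    _·_ : Matrix n → Matrix n → Matrix n
    (M · N) i j = sum (λ k → M i k * N k j)

    _^_ : Matrix n → ℕ → Matrix n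
    M ^ zero  = identity
    M ^ suc k = M · (M ^ k)

    _∘ₛ_ : Matrix n → Matrix n → Matrix n
    (M ∘ₛ N) i j = M i j * N i j

    _⊙_ : Carrier → Matrix n → Matrix n
    (a ⊙ M) i j = a * M i j

    adjacency : Graph n → Matrix n
    adjacency G i j = if does (i ∼? j) then 1# else 0#
      where open Graph G

    OneWalkRegular : Graph n → Set (c ⊔ ℓ₁)
    OneWalkRegular G = ∀ ℓ →
      (∃[ a ] A ^ ℓ ∘ₛ identity ≋ a ⊙ identity) × (∃[ b ] A ^ ℓ ∘ₛ A ≋ b ⊙ A)
      where A = adjacency G

    TwoWalkRegular : Graph n → Set (c ⊔ ℓ₁)
    TwoWalkRegular G =
      OneWalkRegular G × (∀ ℓ → ∃[ c₂ ] A ^ ℓ ∘ₛ A₂ ≋ c₂ ⊙ A₂)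
      where
      A  = adjacency G
      A₂ = adjacency (distance2Graph G)

  ⟨_,_⟩ : ∀ {d} → Vector Carrier d → Vector Carrier d → Carrier
  ⟨ x , y ⟩ = sum (λ k → x k * y k)

  2# : Carrier
  2# = 1# + 1#

  module _ {n : ℕ} (G : Graph n) where
    open Graph G

    record IsVectorColoring (t : Carrier) {d : ℕ} (p : Fin n → Vector Carrier d)
           : Set (ℓ₁ ⊔ ℓ₂) where
      field
        unit : ∀ i → ⟨ p i , p i ⟩ ≈ 1#
        edge : ∀ i j → i ∼ j → ⟨ p i , p j ⟩ ≤ - ((t - 1#) ⁻¹)

    -- The vectors of a coloring live in ℝᵈ for some d, which is not fixed in
    -- advance and may differ between colorings.
    VectorColorable : Carrier → Set (c ⊔ ℓ₁ ⊔ ℓ₂)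
    VectorColorable t = ∃[ d ] ∃ (IsVectorColoring t {d})

    IsVectorChromaticNumber : Carrier → Set (c ⊔ ℓ₁ ⊔ ℓ₂)
    IsVectorChromaticNumber t =
      (2# ≤ t × VectorColorable t) ×
      (∀ {s} → 2# ≤ s → VectorColorable s → t ≤ s)

    UniquelyVectorColorable : Set (c ⊔ ℓ₁ ⊔ ℓ₂)
    UniquelyVectorColorable =
      ∀ {t} → IsVectorChromaticNumber t →
      ∀ {d e} {p : Fin n → Vector Carrier d} {q : Fin n → Vector Carrier e} →
      IsVectorColoring t p → IsVectorColoring t q →
      ∀ i j → ⟨ p i , p j ⟩ ≈ ⟨ q i , q j ⟩

{-# OPTIONS --safe #-}
module Submission where

-- Let τ < 0 be the least eigenvalue of A and k the valency.  The projection E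
-- onto the τ-eigenspace is a polynomial in A, so by walk-regularity its entries
-- are constant on the diagonal, on edges and at distance two.  Its normalised
-- rows p therefore form a vector (1 - k/τ)-coloring, which is optimal because
-- A - τI is positive semidefinite.  No spectral theorem is needed: τ is the
-- supremum of all r with A - rI positive semidefinite, and if f is an
-- annihilating polynomial of M = A - τI with the factors of x removed, scaled to
-- f(0) = 1, then E = f(M).
--
-- Unique colorability makes G connected and makes every endomorphism preserve
-- the Gram matrix of p.  Some power ψ of a given endomorphism is idempotent.  If
-- ψ is not the identity, then by connectedness some fixed v has a neighbour w
-- with ψ w ≢ w.  Then w and ψ w are at distance two and have equal vectors, so
-- all vertices at distance two have equal vectors.  Without triangles, G is then
-- bipartite; with a triangle, every edge lies in one, which rules out distance
-- three, and G is complete multipartite.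

open import Defs
open import Algebra.Bundles using (RawRing; CommutativeRing)
import Algebra.Properties.AbelianGroup as AbelianGroupProperties
import Algebra.Properties.Ring as RingProperties
import Algebra.Properties.Semiring.Mult.TCOptimised as SemiringMult
import Algebra.Properties.Semiring.Sum as SemiringSum
import Algebra.Solver.Ring as RingSolver
open import Algebra.Solver.Ring.AlmostCommutativeRing
  using (fromCommutativeRing; _-Raw-AlmostCommutative⟶_; Induced-equivalence)
open import Data.Bool.Base using (Bool; true; false; if_then_else_)
open import Data.Fin.Base as Fin using (Fin; zero; suc; combine; funToFin; finToFun; punchIn; remQuot; splitAt; toℕ)
open import Data.Fin.Properties as Fin using (any?; all?; pigeonhole; finToFun-funToFin; toℕ<n)
open import Data.Maybe.Base using (just; nothing)
open import Data.Nat.Base as ℕ using (ℕ; zero; suc; _!)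
open import Data.Nat.Divisibility using (_∣_; divides; ∣-trans; n∣m*n; m≤n⇒m!∣n!)
import Data.Nat.Properties as ℕ
open import Data.Product.Base using (_×_; _,_; ∃; ∃-syntax; proj₁; proj₂)
open import Data.Sum.Base using (_⊎_; inj₁; inj₂)
open import Data.Vec.Functional using (Vector; insertAt; _++_; _∷_)
open import Data.Vec.Functional.Properties using (insertAt-lookup; insertAt-punchIn)
open import Function.Base using (_∘_; id)
open import Function.Bundles using (mk⇔)
open import Level using (Level; _⊔_; 0ℓ; Lift; lift; lower)
open import Relation.Binary.Core using (Rel)
open import Relation.Binary.Definitions using (WeaklyDecidable)
open import Relation.Binary.PropositionalEquality as ≡ using (_≡_; _≢_)
import Relation.Binary.Reasoning.Setoid as SetoidReasoning
open import Relation.Binary.Structures using (IsDecEquivalence; IsDecTotalOrder)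
open import Relation.Nullary using (¬_; Dec; yes; no; does; contradiction)
open import Relation.Nullary.Decidable
  using (dec-true; dec-false; ¬?; _⊎-dec_; _×-dec_; _→-dec_; does-⇔; decidable-stable)
open import Relation.Unary using (Pred)
import Relation.Unary as Unary

-- Ring normalisation with integer coefficients

-- The library's abstract ring solver does not cancel x - x unless the
-- coefficients can be computed with, so integer coefficients are supplied
-- here, as formal differences of natural numbers.
module CommutativeRingSolver {c ℓ} (R : CommutativeRing c ℓ) where
  open CommutativeRing R
  open SemiringMult semiring using (×-homo-+; ×1-homo-*)
    renaming (_×_ to _×ᴿ_)
  open RingProperties ring using (-‿distribˡ-*; -‿distribʳ-*; -0#≈0#; -‿involutive)
  open AbelianGroupProperties +-abelianGroup using (⁻¹-∙-comm)
  open import Algebra.Properties.CommutativeSemigroup +-commutativeSemigroup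
    using (interchange)
  open import Relation.Binary.Reasoning.Setoid setoid

  private
    difference : RawRing _ _
    difference = record
      { Carrier = ℕ × ℕ
      ; _≈_     = λ (a , b) (c , d) → a ℕ.+ d ≡ c ℕ.+ b
      ; _+_     = λ (a , b) (c , d) → a ℕ.+ c , b ℕ.+ d
      ; _*_     = λ (a , b) (c , d) → a ℕ.* c ℕ.+ b ℕ.* d , a ℕ.* d ℕ.+ b ℕ.* c
      ; -_      = λ (a , b) → b , a
      ; 0#      = 0 , 0
      ; 1#      = 1 , 0
      }

    ι : ℕ → Carrier
    ι k = k ×ᴿ 1#

    -- Reduces the difference first, so that equal coefficients evaluate to the
    -- same term.
    ⟦_⟧ : ℕ × ℕ → Carrier
    ⟦ suc a , suc b ⟧ = ⟦ a , b ⟧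
    ⟦ a     , zero  ⟧ = ι a
    ⟦ zero  , suc b ⟧ = - ι (suc b)

    +-homo-ι : ∀ a b → ι (a ℕ.+ b) ≈ ι a + ι b
    +-homo-ι = ×-homo-+ 1#

    difference-+ : ∀ x y z w → (x + y) - (z + w) ≈ (x - z) + (y - w)
    difference-+ x y z w = trans (+-congˡ (sym (⁻¹-∙-comm z w))) (interchange _ _ _ _)

    shift : ∀ x y z → x - z ≈ (x + y) - (z + y)
    shift x y z = begin
      x - z              ≈⟨ +-identityʳ _ ⟨
      (x - z) + 0#       ≈⟨ +-congˡ (-‿inverseʳ y) ⟨
      (x - z) + (y - y)  ≈⟨ difference-+ x y z y ⟨
      (x + y) - (z + y)  ∎

    ⟦⟧-difference : ∀ a b → ⟦ a , b ⟧ ≈ ι a - ι b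
    ⟦⟧-difference zero    zero    = sym (-‿inverseʳ 0#)
    ⟦⟧-difference (suc a) zero    = sym (trans (+-congˡ -0#≈0#) (+-identityʳ _))
    ⟦⟧-difference zero    (suc b) = sym (+-identityˡ _)
    ⟦⟧-difference (suc a) (suc b) = begin
      ⟦ a , b ⟧                    ≈⟨ ⟦⟧-difference a b ⟩
      ι a - ι b                    ≈⟨ shift (ι a) 1# (ι b) ⟩
      (ι a + 1#) - (ι b + 1#)      ≈⟨ +-cong (+-comm _ _) (-‿cong (+-comm _ _)) ⟩
      (1# + ι a) - (1# + ι b)      ≈⟨ +-cong (+-homo-ι 1 a) (-‿cong (+-homo-ι 1 b)) ⟨
      ι (suc a) - ι (suc b)        ∎

    +-homo : ∀ p q → ⟦ proj₁ p ℕ.+ proj₁ q , proj₂ p ℕ.+ proj₂ q ⟧ ≈ ⟦ p ⟧ + ⟦ q ⟧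
    +-homo (a , b) (c , d) = begin
      ⟦ a ℕ.+ c , b ℕ.+ d ⟧       ≈⟨ ⟦⟧-difference (a ℕ.+ c) (b ℕ.+ d) ⟩
      ι (a ℕ.+ c) - ι (b ℕ.+ d)   ≈⟨ +-cong (+-homo-ι a c) (-‿cong (+-homo-ι b d)) ⟩
      (ι a + ι c) - (ι b + ι d)   ≈⟨ difference-+ _ _ _ _ ⟩
      (ι a - ι b) + (ι c - ι d)   ≈⟨ +-cong (⟦⟧-difference a b) (⟦⟧-difference c d) ⟨
      ⟦ a , b ⟧ + ⟦ c , d ⟧       ∎

    -‿homo : ∀ a b → ⟦ b , a ⟧ ≈ - ⟦ a , b ⟧
    -‿homo a b = begin
      ⟦ b , a ⟧          ≈⟨ ⟦⟧-difference b a ⟩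
      ι b - ι a          ≈⟨ +-comm _ _ ⟩
      - ι a + ι b        ≈⟨ +-congˡ (-‿involutive _) ⟨
      - ι a + - (- ι b)  ≈⟨ ⁻¹-∙-comm _ _ ⟩
      - (ι a - ι b)      ≈⟨ -‿cong (⟦⟧-difference a b) ⟨
      - ⟦ a , b ⟧        ∎

    ι-*+* : ∀ a b c d → ι (a ℕ.* b ℕ.+ c ℕ.* d) ≈ ι a * ι b + ι c * ι d
    ι-*+* a b c d = trans (+-homo-ι (a ℕ.* b) (c ℕ.* d)) (+-cong (×1-homo-* a b) (×1-homo-* c d))

    *-homo : ∀ p q → ⟦ proj₁ p ℕ.* proj₁ q ℕ.+ proj₂ p ℕ.* proj₂ q
                     , proj₁ p ℕ.* proj₂ q ℕ.+ proj₂ p ℕ.* proj₁ q ⟧ ≈ ⟦ p ⟧ * ⟦ q ⟧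
    *-homo (a , b) (c , d) = begin
      ⟦ a ℕ.* c ℕ.+ b ℕ.* d , a ℕ.* d ℕ.+ b ℕ.* c ⟧
        ≈⟨ ⟦⟧-difference (a ℕ.* c ℕ.+ b ℕ.* d) (a ℕ.* d ℕ.+ b ℕ.* c) ⟩
      ι (a ℕ.* c ℕ.+ b ℕ.* d) - ι (a ℕ.* d ℕ.+ b ℕ.* c)
        ≈⟨ +-cong (ι-*+* a c b d) (-‿cong (ι-*+* a d b c)) ⟩
      (ι a * ι c + ι b * ι d) - (ι a * ι d + ι b * ι c)
        ≈⟨ difference-+ _ _ _ _ ⟩
      (ι a * ι c - ι a * ι d) + (ι b * ι d - ι b * ι c)
        ≈⟨ +-cong (+-congˡ (-‿distribʳ-* _ _)) (+-comm _ _) ⟩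
      (ι a * ι c + ι a * - ι d) + (- (ι b * ι c) + ι b * ι d)
        ≈⟨ +-cong (sym (distribˡ _ _ _))
             (+-cong (-‿distribˡ-* _ _) (trans (sym (-‿involutive _))
               (trans (-‿cong (-‿distribˡ-* _ _)) (-‿distribʳ-* _ _)))) ⟩
      ι a * (ι c - ι d) + (- ι b * ι c + - ι b * - ι d)
        ≈⟨ +-congˡ (distribˡ _ _ _) ⟨
      ι a * (ι c - ι d) + - ι b * (ι c - ι d)
        ≈⟨ distribʳ _ _ _ ⟨
      (ι a - ι b) * (ι c - ι d)
        ≈⟨ *-cong (⟦⟧-difference a b) (⟦⟧-difference c d) ⟨
      ⟦ a , b ⟧ * ⟦ c , d ⟧ ∎

    morphism : difference -Raw-AlmostCommutative⟶ fromCommutativeRing R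
    morphism = record
      { ⟦_⟧    = ⟦_⟧
      ; +-homo = +-homo
      ; *-homo = *-homo
      ; -‿homo = λ (a , b) → -‿homo a b
      ; 0-homo = refl
      ; 1-homo = refl
      }

    -- Formal differences are compared through their cross sums in `ℕ`. Padding both differences to
    -- a common form shows that equal cross sums give equal values in every ring.
    difference≟ : WeaklyDecidable (Induced-equivalence morphism)
    difference≟ (a , b) (c , d) with a ℕ.+ d ℕ.≟ c ℕ.+ b
    ... | no  _        = nothing
    ... | yes a+d≡c+b = just (begin
      ⟦ a , b ⟧                  ≈⟨ ⟦⟧-difference a b ⟩
      ι a - ι b                  ≈⟨ shift (ι a) (ι d) (ι b) ⟩
      (ι a + ι d) - (ι b + ι d)  ≈⟨ +-congʳ (+-homo-ι a d) ⟨
      ι (a ℕ.+ d) - (ι b + ι d)  ≡⟨ ≡.cong (λ k → ι k - (ι b + ι d)) a+d≡c+b ⟩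
      ι (c ℕ.+ b) - (ι b + ι d)  ≈⟨ +-cong (+-homo-ι c b) (-‿cong (+-comm _ _)) ⟩
      (ι c + ι b) - (ι d + ι b)  ≈⟨ shift (ι c) (ι b) (ι d) ⟨
      ι c - ι d                  ≈⟨ ⟦⟧-difference c d ⟨
      ⟦ c , d ⟧                  ∎)

  open RingSolver difference (fromCommutativeRing R) morphism difference≟ public
    using (solve; Polynomial; _:=_; _:+_; _:*_; _:-_; :-_; con)

  :1 : ∀ {n} → Polynomial n
  :1 = con (1 , 0)
  :0 : ∀ {n} → Polynomial n
  :0 = con (0 , 0)

-- Arithmetic of the ordered field and finite sums

module OrderedField {c ℓ₁ ℓ₂ : Level} (ℝ : CompleteOrderedField c ℓ₁ ℓ₂) where
  open CompleteOrderedField ℝ public hiding (zero)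
  open IsDecTotalOrder isDecTotalOrder public
    using (_≟_)
    renaming ( refl to ≤-refl; reflexive to ≤-reflexive; trans to ≤-trans
             ; antisym to ≤-antisym; total to ≤-total
             ; ≤-respˡ-≈ to ≤-respˡ-≈; ≤-respʳ-≈ to ≤-respʳ-≈ )
  open CommutativeRingSolver commutativeRing public
  open SemiringSum semiring public
    using (sum; sum-cong-≋; ∑-distrib-+; ∑-comm; sum-remove; *-distribˡ-sum; *-distribʳ-sum; sum-replicate-zero)
  module ≈-Reasoning = SetoidReasoning setoid
  open ≈-Reasoning

  ≤-resp₂-≈ : ∀ {x y z w} → x ≈ y → z ≈ w → x ≤ z → y ≤ w
  ≤-resp₂-≈ x≈y z≈w x≤z = ≤-respˡ-≈ x≈y (≤-respʳ-≈ z≈w x≤z)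

  x≤y⇒0≤y-x : ∀ {x y} → x ≤ y → 0# ≤ y - x
  x≤y⇒0≤y-x {x} {y} x≤y = ≤-respˡ-≈ (-‿inverseʳ x) (+-monoˡ-≤ (- x) x≤y)

  0≤y-x⇒x≤y : ∀ {x y} → 0# ≤ y - x → x ≤ y
  0≤y-x⇒x≤y {x} {y} 0≤y-x =
    ≤-resp₂-≈ (+-identityˡ x) (solve 2 (λ x y → (y :- x) :+ x := y) refl x y) (+-monoˡ-≤ x 0≤y-x)

  +-mono-≤ : ∀ {x y z w} → x ≤ y → z ≤ w → x + z ≤ y + w
  +-mono-≤ {x} {y} {z} {w} x≤y z≤w =
    ≤-trans (+-monoˡ-≤ z x≤y) (≤-resp₂-≈ (+-comm z y) (+-comm w y) (+-monoˡ-≤ y z≤w))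

  +-nonNegative : ∀ {x y} → 0# ≤ x → 0# ≤ y → 0# ≤ x + y
  +-nonNegative 0≤x 0≤y = ≤-respˡ-≈ (+-identityˡ 0#) (+-mono-≤ 0≤x 0≤y)

  -‿antimono-≤ : ∀ {x y} → x ≤ y → - y ≤ - x
  -‿antimono-≤ {x} {y} x≤y = 0≤y-x⇒x≤y (≤-respʳ-≈
    (solve 2 (λ x y → y :- x := (:- x) :- (:- y)) refl x y) (x≤y⇒0≤y-x x≤y))

  square-nonNegative : ∀ x → 0# ≤ x * x
  square-nonNegative x with ≤-total 0# x
  ... | inj₁ 0≤x = *-nonNegative 0≤x 0≤x
  ... | inj₂ x≤0 = ≤-respʳ-≈ (solve 1 (λ x → (:0 :- x) :* (:0 :- x) := x :* x) refl x)
                     (*-nonNegative (x≤y⇒0≤y-x x≤0) (x≤y⇒0≤y-x x≤0))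

  0≤1 : 0# ≤ 1#
  0≤1 = ≤-respʳ-≈ (*-identityˡ 1#) (square-nonNegative 1#)

  1≉0 : ¬ (1# ≈ 0#)
  1≉0 = 0≉1 ∘ sym

  -- For `x ≤ 0` the sum `x + x` is at most `x`, so `x` is nonnegative in either case. This takes
  -- the place of a division by two.
  halve-nonNegative : ∀ {x} → 0# ≤ x + x → 0# ≤ x
  halve-nonNegative {x} 0≤x+x with ≤-total 0# x
  ... | inj₁ 0≤x = 0≤x
  ... | inj₂ x≤0 = ≤-trans 0≤x+x (≤-respʳ-≈ (+-identityˡ x) (+-monoˡ-≤ x x≤0))

  1≤x⇒x≉0 : ∀ {x} → 1# ≤ x → ¬ (x ≈ 0#)
  1≤x⇒x≉0 1≤x x≈0 = 0≉1 (≤-antisym 0≤1 (≤-respʳ-≈ x≈0 1≤x))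

  ⁻¹-inverseˡ : ∀ {x} → ¬ (x ≈ 0#) → x ⁻¹ * x ≈ 1#
  ⁻¹-inverseˡ x≉0 = trans (*-comm _ _) (⁻¹-inverseʳ x≉0)

  *-cancelˡ-≈ : ∀ {x y z} → ¬ (x ≈ 0#) → x * y ≈ x * z → y ≈ z
  *-cancelˡ-≈ {x} {y} {z} x≉0 xy≈xz = begin
    y                ≈⟨ insert y ⟩
    x ⁻¹ * (x * y)   ≈⟨ *-congˡ xy≈xz ⟩
    x ⁻¹ * (x * z)   ≈⟨ insert z ⟨
    z                ∎
    where
    insert : ∀ w → w ≈ x ⁻¹ * (x * w)
    insert w = trans (sym (*-identityˡ w))
      (trans (*-congʳ (sym (⁻¹-inverseˡ x≉0))) (*-assoc _ _ _))

  x*y≈0⇒y≈0 : ∀ {x y} → ¬ (x ≈ 0#) → x * y ≈ 0# → y ≈ 0#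
  x*y≈0⇒y≈0 x≉0 xy≈0 = *-cancelˡ-≈ x≉0 (trans xy≈0 (sym (zeroʳ _)))

  square≈0⇒≈0 : ∀ {x} → x * x ≈ 0# → x ≈ 0#
  square≈0⇒≈0 {x} xx≈0 with x ≟ 0#
  ... | yes x≈0 = x≈0
  ... | no  x≉0 = x*y≈0⇒y≈0 x≉0 xx≈0

  ⁻¹-unique : ∀ {x y} → ¬ (x ≈ 0#) → x * y ≈ 1# → y ≈ x ⁻¹
  ⁻¹-unique x≉0 xy≈1 = *-cancelˡ-≈ x≉0 (trans xy≈1 (sym (⁻¹-inverseʳ x≉0)))

  ⁻¹-≉0 : ∀ {x} → ¬ (x ≈ 0#) → ¬ (x ⁻¹ ≈ 0#)
  ⁻¹-≉0 {x} x≉0 x⁻¹≈0 = 0≉1 (trans (sym (zeroʳ x)) (trans (*-congˡ (sym x⁻¹≈0)) (⁻¹-inverseʳ x≉0)))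

  -- `x ⁻¹` is the product of `x` and the square of `x ⁻¹`.
  ⁻¹-nonNegative : ∀ {x} → 0# ≤ x → ¬ (x ≈ 0#) → 0# ≤ x ⁻¹
  ⁻¹-nonNegative {x} 0≤x x≉0 = ≤-respʳ-≈
    (trans (sym (*-assoc _ _ _)) (trans (*-congʳ (⁻¹-inverseʳ x≉0)) (*-identityˡ _)))
    (*-nonNegative 0≤x (square-nonNegative (x ⁻¹)))

  *-monoˡ-≤ : ∀ {x y z} → 0# ≤ z → x ≤ y → z * x ≤ z * y
  *-monoˡ-≤ {x} {y} {z} 0≤z x≤y = 0≤y-x⇒x≤y (≤-respʳ-≈
    (solve 3 (λ x y z → z :* (y :- x) := z :* y :- z :* x) refl x y z)
    (*-nonNegative 0≤z (x≤y⇒0≤y-x x≤y)))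

  *-cancelˡ-≤ : ∀ {x y z} → 0# ≤ z → ¬ (z ≈ 0#) → z * x ≤ z * y → x ≤ y
  *-cancelˡ-≤ {x} {y} {z} 0≤z z≉0 zx≤zy =
    ≤-resp₂-≈ (cancel x) (cancel y) (*-monoˡ-≤ (⁻¹-nonNegative 0≤z z≉0) zx≤zy)
    where
    cancel : ∀ w → z ⁻¹ * (z * w) ≈ w
    cancel w = trans (sym (*-assoc _ _ _)) (trans (*-congʳ (⁻¹-inverseˡ z≉0)) (*-identityˡ w))

  sum-mono-≤ : ∀ {n} {f g : Vector Carrier n} → (∀ i → f i ≤ g i) → sum f ≤ sum g
  sum-mono-≤ {zero}  f≤g = ≤-refl
  sum-mono-≤ {suc n} f≤g = +-mono-≤ (f≤g zero) (sum-mono-≤ (f≤g ∘ suc))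

  sum-zero : ∀ {n} {f : Vector Carrier n} → (∀ i → f i ≈ 0#) → sum f ≈ 0#
  sum-zero {n} f≈0 = trans (sum-cong-≋ f≈0) (sum-replicate-zero n)

  sum-nonNegative : ∀ {n} {f : Vector Carrier n} → (∀ i → 0# ≤ f i) → 0# ≤ sum f
  sum-nonNegative {n} 0≤f = ≤-respˡ-≈ (sum-replicate-zero n) (sum-mono-≤ 0≤f)

  term≤sum : ∀ {n} {f : Vector Carrier n} → (∀ i → 0# ≤ f i) → ∀ i → f i ≤ sum f
  term≤sum {suc n} 0≤f zero    = ≤-respˡ-≈ (+-identityʳ _) (+-mono-≤ ≤-refl (sum-nonNegative (0≤f ∘ suc)))
  term≤sum {suc n} 0≤f (suc i) = ≤-respˡ-≈ (+-identityˡ _) (+-mono-≤ (0≤f zero) (term≤sum (0≤f ∘ suc) i))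

  sum≈0⇒term≈0 : ∀ {n} {f : Vector Carrier n} → (∀ i → 0# ≤ f i) → sum f ≈ 0# → ∀ i → f i ≈ 0#
  sum≈0⇒term≈0 0≤f ∑f≈0 i = ≤-antisym (≤-respʳ-≈ ∑f≈0 (term≤sum 0≤f i)) (0≤f i)

  -- A sum of copies of some `a ≤ 0` is at most a single copy. The index argument excludes the empty
  -- sum.
  sum-constant-nonNegative : ∀ {n} (i : Fin n) {a} → 0# ≤ sum {n} (λ _ → a) → 0# ≤ a
  sum-constant-nonNegative {suc n} _ {a} 0≤∑a with ≤-total 0# a
  ... | inj₁ 0≤a = 0≤a
  ... | inj₂ a≤0 = ≤-trans 0≤∑a (≤-respʳ-≈ (+-identityʳ a)
                     (+-mono-≤ ≤-refl (≤-respʳ-≈ (sum-replicate-zero n) (sum-mono-≤ {n} (λ _ → a≤0)))))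

-- Inner products and Kronecker products of vectors

module InnerProducts {c ℓ₁ ℓ₂ : Level} (ℝ : CompleteOrderedField c ℓ₁ ℓ₂) where
  open OrderedField ℝ
  open ≈-Reasoning

  ⟪_,_⟫ : ∀ {d} → Vector Carrier d → Vector Carrier d → Carrier
  ⟪_,_⟫ = ⟨_,_⟩ ℝ

  private variable
    d : ℕ
    x y z x′ y′ : Vector Carrier d

  ⟪⟫-cong : (∀ k → x k ≈ x′ k) → (∀ k → y k ≈ y′ k) → ⟪ x , y ⟫ ≈ ⟪ x′ , y′ ⟫
  ⟪⟫-cong x≈x′ y≈y′ = sum-cong-≋ (λ k → *-cong (x≈x′ k) (y≈y′ k))

  ⟪⟫-congˡ : (∀ k → y k ≈ y′ k) → ⟪ x , y ⟫ ≈ ⟪ x , y′ ⟫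
  ⟪⟫-congˡ = ⟪⟫-cong (λ _ → refl)

  ⟪⟫-congʳ : (∀ k → x k ≈ x′ k) → ⟪ x , y ⟫ ≈ ⟪ x′ , y ⟫
  ⟪⟫-congʳ x≈x′ = ⟪⟫-cong x≈x′ (λ _ → refl)

  ⟪⟫-comm : (x y : Vector Carrier d) → ⟪ x , y ⟫ ≈ ⟪ y , x ⟫
  ⟪⟫-comm x y = sum-cong-≋ (λ k → *-comm (x k) (y k))

  ⟪⟫-+*ʳ : ∀ (x y : Vector Carrier d) a z → ⟪ x , (λ k → y k + a * z k) ⟫ ≈ ⟪ x , y ⟫ + a * ⟪ x , z ⟫
  ⟪⟫-+*ʳ x y a z = begin
    sum (λ k → x k * (y k + a * z k))
      ≈⟨ sum-cong-≋ (λ k → solve 4 (λ x y a z → x :* (y :+ a :* z) := x :* y :+ a :* (x :* z)) refl (x k) (y k) a (z k)) ⟩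
    sum (λ k → x k * y k + a * (x k * z k))
      ≈⟨ ∑-distrib-+ (λ k → x k * y k) (λ k → a * (x k * z k)) ⟩
    ⟪ x , y ⟫ + sum (λ k → a * (x k * z k))
      ≈⟨ +-congˡ (*-distribˡ-sum a (λ k → x k * z k)) ⟨
    ⟪ x , y ⟫ + a * ⟪ x , z ⟫ ∎

  ⟪⟫-*ʳ : ∀ (x : Vector Carrier d) a z → ⟪ x , (λ k → a * z k) ⟫ ≈ a * ⟪ x , z ⟫
  ⟪⟫-*ʳ x a z = trans
    (sum-cong-≋ (λ k → solve 3 (λ x a z → x :* (a :* z) := a :* (x :* z)) refl (x k) a (z k)))
    (sym (*-distribˡ-sum a (λ k → x k * z k)))

  ⟪⟫-+*ˡ : ∀ (x : Vector Carrier d) a z y → ⟪ (λ k → x k + a * z k) , y ⟫ ≈ ⟪ x , y ⟫ + a * ⟪ z , y ⟫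
  ⟪⟫-+*ˡ x a z y = begin
    ⟪ (λ k → x k + a * z k) , y ⟫  ≈⟨ ⟪⟫-comm _ y ⟩
    ⟪ y , (λ k → x k + a * z k) ⟫  ≈⟨ ⟪⟫-+*ʳ y x a z ⟩
    ⟪ y , x ⟫ + a * ⟪ y , z ⟫      ≈⟨ +-cong (⟪⟫-comm y x) (*-congˡ (⟪⟫-comm y z)) ⟩
    ⟪ x , y ⟫ + a * ⟪ z , y ⟫      ∎

  ⟪⟫-nonNegative : (x : Vector Carrier d) → 0# ≤ ⟪ x , x ⟫
  ⟪⟫-nonNegative x = sum-nonNegative (λ k → square-nonNegative (x k))

  ⟪x,x⟫≈0⇒x≈0 : (x : Vector Carrier d) → ⟪ x , x ⟫ ≈ 0# → ∀ k → x k ≈ 0#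
  ⟪x,x⟫≈0⇒x≈0 x xx≈0 k = square≈0⇒≈0 (sum≈0⇒term≈0 (λ i → square-nonNegative (x i)) xx≈0 k)

  norm²-+* : ∀ (x : Vector Carrier d) a y → let z = λ k → x k + a * y k in
             ⟪ z , z ⟫ ≈ ⟪ x , x ⟫ + a * (⟪ x , y ⟫ + ⟪ x , y ⟫) + a * a * ⟪ y , y ⟫
  norm²-+* x a y = let z = λ k → x k + a * y k in begin
    ⟪ z , z ⟫
      ≈⟨ ⟪⟫-+*ˡ x a y z ⟩
    ⟪ x , z ⟫ + a * ⟪ y , z ⟫
      ≈⟨ +-cong (⟪⟫-+*ʳ x x a y) (*-congˡ (trans (⟪⟫-+*ʳ y x a y) (+-congʳ (⟪⟫-comm y x)))) ⟩
    (⟪ x , x ⟫ + a * ⟪ x , y ⟫) + a * (⟪ x , y ⟫ + a * ⟪ y , y ⟫)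
      ≈⟨ solve 4 (λ p q r a → (p :+ a :* q) :+ a :* (q :+ a :* r)
                            := p :+ a :* (q :+ q) :+ a :* a :* r) refl _ _ _ a ⟩
    ⟪ x , x ⟫ + a * (⟪ x , y ⟫ + ⟪ x , y ⟫) + a * a * ⟪ y , y ⟫ ∎

  -- The equality case of Cauchy-Schwarz: the difference of the two vectors has squared norm 1 - 2 +
  -- 1.
  unit-⟪⟫≈1⇒≈ : (x y : Vector Carrier d) → ⟪ x , x ⟫ ≈ 1# → ⟪ y , y ⟫ ≈ 1# → ⟪ x , y ⟫ ≈ 1# →
                ∀ k → x k ≈ y k
  unit-⟪⟫≈1⇒≈ x y xx≈1 yy≈1 xy≈1 k = begin
    x k                          ≈⟨ solve 2 (λ x y → x := (x :+ (:- :1) :* y) :+ y) refl (x k) (y k) ⟩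
    (x k + - 1# * y k) + y k     ≈⟨ +-congʳ (⟪x,x⟫≈0⇒x≈0 (λ k → x k + - 1# * y k) diff≈0 k) ⟩
    0# + y k                     ≈⟨ +-identityˡ _ ⟩
    y k                          ∎
    where
    diff≈0 : ⟪ (λ k → x k + - 1# * y k) , (λ k → x k + - 1# * y k) ⟫ ≈ 0#
    diff≈0 = begin
      ⟪ (λ k → x k + - 1# * y k) , (λ k → x k + - 1# * y k) ⟫
        ≈⟨ norm²-+* x (- 1#) y ⟩
      ⟪ x , x ⟫ + - 1# * (⟪ x , y ⟫ + ⟪ x , y ⟫) + - 1# * - 1# * ⟪ y , y ⟫
        ≈⟨ +-cong (+-cong xx≈1 (*-congˡ (+-cong xy≈1 xy≈1))) (*-congˡ yy≈1) ⟩
      1# + - 1# * (1# + 1#) + - 1# * - 1# * 1#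
        ≈⟨ solve 0 (:1 :+ (:- :1) :* (:1 :+ :1) :+ (:- :1) :* (:- :1) :* :1 := :0) refl ⟩
      0# ∎

  sum-++ : ∀ {m n} (x : Vector Carrier m) (y : Vector Carrier n) → sum (x ++ y) ≈ sum x + sum y
  sum-++ {zero}  x y = sym (+-identityˡ _)
  sum-++ {suc m} x y = trans
    (+-congˡ (trans (sum-cong-≋ shift) (sum-++ (x ∘ suc) y)))
    (sym (+-assoc _ _ _))
    where
    shift : ∀ i → (x ++ y) (suc i) ≈ ((x ∘ suc) ++ y) i
    shift i with splitAt m i
    ... | inj₁ _ = refl
    ... | inj₂ _ = refl

  ⟪⟫-++ : ∀ {m n} (x x′ : Vector Carrier m) (y y′ : Vector Carrier n) →
          ⟪ x ++ y , x′ ++ y′ ⟫ ≈ ⟪ x , x′ ⟫ + ⟪ y , y′ ⟫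
  ⟪⟫-++ {m} x x′ y y′ = trans (sum-cong-≋ pointwise) (sum-++ (λ k → x k * x′ k) (λ k → y k * y′ k))
    where
    pointwise : ∀ i → (x ++ y) i * (x′ ++ y′) i ≈ ((λ k → x k * x′ k) ++ (λ k → y k * y′ k)) i
    pointwise i with splitAt m i
    ... | inj₁ _ = refl
    ... | inj₂ _ = refl

  -- The Kronecker product. Tensoring a family of vectors with `s` multiplies its Gram matrix by
  -- `⟪ s , s ⟫`.
  _⊗_ : ∀ {m n} → Vector Carrier m → Vector Carrier n → Vector Carrier (m ℕ.* n)
  _⊗_ {zero}  s x = λ ()
  _⊗_ {suc m} s x = (λ k → s zero * x k) ++ ((s ∘ suc) ⊗ x)

  ⟪⟫-⊗ : ∀ {m n} (s : Vector Carrier m) (x y : Vector Carrier n) →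
         ⟪ s ⊗ x , s ⊗ y ⟫ ≈ ⟪ s , s ⟫ * ⟪ x , y ⟫
  ⟪⟫-⊗ {zero}  s x y = sym (zeroˡ _)
  ⟪⟫-⊗ {suc m} s x y = begin
    ⟪ s ⊗ x , s ⊗ y ⟫
      ≈⟨ ⟪⟫-++ (λ k → s zero * x k) (λ k → s zero * y k) (t ⊗ x) (t ⊗ y) ⟩
    ⟪ (λ k → s zero * x k) , (λ k → s zero * y k) ⟫ + ⟪ t ⊗ x , t ⊗ y ⟫
      ≈⟨ +-cong (trans (⟪⟫-*ʳ _ (s zero) y) (*-congˡ (trans (⟪⟫-comm _ y) (⟪⟫-*ʳ y (s zero) x)))) (⟪⟫-⊗ t x y) ⟩
    s zero * (s zero * ⟪ y , x ⟫) + ⟪ t , t ⟫ * ⟪ x , y ⟫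
      ≈⟨ +-congʳ (*-congˡ (*-congˡ (⟪⟫-comm y x))) ⟩
    s zero * (s zero * ⟪ x , y ⟫) + ⟪ t , t ⟫ * ⟪ x , y ⟫
      ≈⟨ solve 3 (λ s t p → s :* (s :* p) :+ t :* p := (s :* s :+ t) :* p) refl _ _ _ ⟩
    ⟪ s , s ⟫ * ⟪ x , y ⟫ ∎
    where t = s ∘ suc

-- Linear dependence by Gaussian elimination

module LinearDependence {c ℓ₁ ℓ₂ : Level} (ℝ : CompleteOrderedField c ℓ₁ ℓ₂) where
  open OrderedField ℝ
  open ≈-Reasoning

  -- Elimination of the first coordinate. If it vanishes on all vectors, one vector is spare and
  -- gets coefficient zero. Otherwise a pivot clears it from the other vectors, and a relation among
  -- the cleared vectors extends to the pivot.
  linearDependence : ∀ N (v : Fin (suc N) → Vector Carrier N) →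
    ∃ λ (c : Vector Carrier (suc N)) →
      (∃[ k ] ¬ (c k ≈ 0#)) × (∀ i → sum (λ k → c k * v k i) ≈ 0#)
  linearDependence zero    v = (λ _ → 1#) , (zero , 1≉0) , λ ()
  linearDependence (suc N) v with any? (λ k → ¬? (v k zero ≟ 0#))
  ... | no all≈0 with linearDependence N (λ k i → v (suc k) (suc i))
  ...   | c , (k , ck≉0) , rel = c′ , (suc k , ck≉0) , rel′
    where
    c′ : Vector Carrier _
    c′ zero    = 0#
    c′ (suc k) = c k
    v0≈0 : ∀ k → v k zero ≈ 0#
    v0≈0 k with v k zero ≟ 0#
    ... | yes p = p
    ... | no ¬p = contradiction (k , ¬p) all≈0
    rel′ : ∀ i → sum (λ k → c′ k * v k i) ≈ 0#
    rel′ zero    = sum-zero (λ k → trans (*-congˡ {x = c′ k} (v0≈0 k)) (zeroʳ (c′ k)))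
    rel′ (suc i) = trans (+-cong (zeroˡ _) (rel i)) (+-identityˡ _)
  linearDependence (suc N) v | yes (p , pivot≉0)
    with linearDependence N (λ k i → v (punchIn p k) (suc i) - v (punchIn p k) zero * v p zero ⁻¹ * v p (suc i))
  ... | d , (k , dk≉0) , rel = c′ , (punchIn p k , ck≉0) , rel′
    where
    r : Vector Carrier _
    r k = v (punchIn p k) zero * v p zero ⁻¹
    -- The cleared vector with index `k` contains `- r k` times the pivot, so this is the total
    -- coefficient of the pivot in the relation `d`.
    a : Carrier
    a = - sum (λ k → d k * r k)
    c′ : Vector Carrier _
    c′ = insertAt d p a
    ck≉0 : ¬ (c′ (punchIn p k) ≈ 0#)
    ck≉0 c≈0 = dk≉0 (trans (reflexive (≡.sym (insertAt-punchIn d p a k))) c≈0)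
    expand : ∀ i → sum (λ k → c′ k * v k i) ≈ sum (λ k → d k * (v (punchIn p k) i - r k * v p i))
    expand i = begin
      sum (λ k → c′ k * v k i)
        ≈⟨ sum-remove {i = p} (λ k → c′ k * v k i) ⟩
      c′ p * v p i + sum (λ k → c′ (punchIn p k) * v (punchIn p k) i)
        ≈⟨ +-cong (*-congʳ (reflexive (insertAt-lookup d p a)))
             (sum-cong-≋ (λ k → *-congʳ {x = v (punchIn p k) i} (reflexive (insertAt-punchIn d p a k)))) ⟩
      a * v p i + sum (λ k → d k * v (punchIn p k) i)
        ≈⟨ +-congʳ (solve 2 (λ s t → (:- s) :* t := s :* (:- t)) refl _ _) ⟩
      sum (λ k → d k * r k) * - v p i + sum (λ k → d k * v (punchIn p k) i)
        ≈⟨ +-congʳ (*-distribʳ-sum (- v p i) (λ k → d k * r k)) ⟩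
      sum (λ k → d k * r k * - v p i) + sum (λ k → d k * v (punchIn p k) i)
        ≈⟨ ∑-distrib-+ (λ k → d k * r k * - v p i) (λ k → d k * v (punchIn p k) i) ⟨
      sum (λ k → d k * r k * - v p i + d k * v (punchIn p k) i)
        ≈⟨ sum-cong-≋ (λ k → solve 4 (λ d r x y → d :* r :* (:- x) :+ d :* y := d :* (y :- r :* x)) refl
             (d k) (r k) (v p i) (v (punchIn p k) i)) ⟩
      sum (λ k → d k * (v (punchIn p k) i - r k * v p i)) ∎
    rel′ : ∀ i → sum (λ k → c′ k * v k i) ≈ 0#
    rel′ (suc i) = trans (expand (suc i)) (rel i)
    rel′ zero    = trans (expand zero) (sum-zero (λ k → trans (*-congˡ {x = d k} (cancel k)) (zeroʳ (d k))))
      where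
      cancel : ∀ k → v (punchIn p k) zero - r k * v p zero ≈ 0#
      cancel k = begin
        x - x * y ⁻¹ * y    ≈⟨ solve 3 (λ x z y → x :- x :* z :* y := x :- x :* (z :* y)) refl x (y ⁻¹) y ⟩
        x - x * (y ⁻¹ * y)  ≈⟨ +-congˡ (-‿cong (*-congˡ (⁻¹-inverseˡ pivot≉0))) ⟩
        x - x * 1#          ≈⟨ solve 1 (λ x → x :- x :* :1 := :0) refl x ⟩
        0#                  ∎
        where x = v (punchIn p k) zero ; y = v p zero

-- Matrices and quadratic forms

module Matrices {c ℓ₁ ℓ₂ : Level} (ℝ : CompleteOrderedField c ℓ₁ ℓ₂) where
  open OrderedField ℝ
  open InnerProducts ℝ
  open LinearDependence ℝ
  open ≈-Reasoning

  private variable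
    m n : ℕ

  Mat : ℕ → Set c
  Mat = Matrix ℝ

  𝟙 : Mat n
  𝟙 = identity ℝ

  infixl 7 _⊡_
  _⊡_ : Mat n → Mat n → Mat n
  _⊡_ = _·_ ℝ

  infixr 8 _⋆_
  _⋆_ : Mat n → Vector Carrier n → Vector Carrier n
  (M ⋆ x) i = ⟪ M i , x ⟫

  Sym : Mat n → Set ℓ₁
  Sym M = ∀ i j → M i j ≈ M j i

  𝟙-diagonal : (i : Fin n) → 𝟙 i i ≈ 1#
  𝟙-diagonal i = reflexive (≡.cong (λ b → if b then 1# else 0#) (dec-true (i Fin.≟ i) ≡.refl))

  𝟙-offDiagonal : {i j : Fin n} → i ≢ j → 𝟙 i j ≈ 0#
  𝟙-offDiagonal {i = i} {j} i≢j = reflexive (≡.cong (λ b → if b then 1# else 0#) (dec-false (i Fin.≟ j) i≢j))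

  𝟙-sym : Sym {n} 𝟙
  𝟙-sym i j with i Fin.≟ j
  ... | yes ≡.refl = sym (𝟙-diagonal i)
  ... | no i≢j     = sym (𝟙-offDiagonal (i≢j ∘ ≡.sym))

  ⟪𝟙,⟫ : ∀ (i : Fin n) x → ⟪ 𝟙 i , x ⟫ ≈ x i
  ⟪𝟙,⟫ zero    x = trans (+-cong (*-identityˡ _) (sum-zero (λ k → zeroˡ (x (suc k))))) (+-identityʳ _)
  ⟪𝟙,⟫ (suc i) x = trans (+-cong (zeroˡ _) (⟪𝟙,⟫ i (x ∘ suc))) (+-identityˡ _)

  -- An exchange of two finite sums. `N` may be rectangular, so that the identity serves matrix
  -- products, adjoints, polynomial coefficients and Gram matrices alike.
  ⟪⟫-assoc : ∀ {k} (u : Vector Carrier m) (N : Fin m → Fin k → Carrier) x →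
             ⟪ (λ j → ⟪ u , (λ i → N i j) ⟫) , x ⟫ ≈ ⟪ u , (λ i → ⟪ N i , x ⟫) ⟫
  ⟪⟫-assoc u N x = begin
    sum (λ j → sum (λ i → u i * N i j) * x j)
      ≈⟨ sum-cong-≋ (λ j → trans (*-distribʳ-sum (x j) (λ i → u i * N i j))
           (sum-cong-≋ (λ i → *-assoc (u i) (N i j) (x j)))) ⟩
    sum (λ j → sum (λ i → u i * (N i j * x j)))
      ≈⟨ ∑-comm (λ j i → u i * (N i j * x j)) ⟩
    sum (λ i → sum (λ j → u i * (N i j * x j)))
      ≈⟨ sum-cong-≋ (λ i → sym (*-distribˡ-sum (u i) (λ j → N i j * x j))) ⟩
    sum (λ i → u i * sum (λ j → N i j * x j)) ∎

  ⋆-⊡ : ∀ (M N : Mat n) x i → ((M ⊡ N) ⋆ x) i ≈ (M ⋆ N ⋆ x) i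
  ⋆-⊡ M N x i = ⟪⟫-assoc (M i) N x

  𝟙-⋆ : ∀ (x : Vector Carrier n) i → (𝟙 ⋆ x) i ≈ x i
  𝟙-⋆ x i = ⟪𝟙,⟫ i x

  ⊡-assoc : ∀ (M N P : Mat n) i j → ((M ⊡ N) ⊡ P) i j ≈ (M ⊡ (N ⊡ P)) i j
  ⊡-assoc M N P i j = ⟪⟫-assoc (M i) N (λ k → P k j)

  ⊡-congˡ : ∀ (M : Mat n) {N P : Mat n} → (∀ i j → N i j ≈ P i j) → ∀ i j → (M ⊡ N) i j ≈ (M ⊡ P) i j
  ⊡-congˡ M N≈P i j = ⟪⟫-congˡ (λ k → N≈P k j)

  ⊡-congʳ : ∀ (M : Mat n) {N P : Mat n} → (∀ i j → N i j ≈ P i j) → ∀ i j → (N ⊡ M) i j ≈ (P ⊡ M) i j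
  ⊡-congʳ M N≈P i j = ⟪⟫-congʳ (λ k → N≈P i k)

  ⊡-identityˡ : ∀ (M : Mat n) i j → (𝟙 ⊡ M) i j ≈ M i j
  ⊡-identityˡ M i j = ⟪𝟙,⟫ i (λ k → M k j)

  ⊡-identityʳ : ∀ (M : Mat n) i j → (M ⊡ 𝟙) i j ≈ M i j
  ⊡-identityʳ M i j = begin
    ⟪ M i , (λ k → 𝟙 k j) ⟫  ≈⟨ ⟪⟫-congˡ (λ k → 𝟙-sym k j) ⟩
    ⟪ M i , 𝟙 j ⟫            ≈⟨ ⟪⟫-comm (M i) (𝟙 j) ⟩
    ⟪ 𝟙 j , M i ⟫            ≈⟨ ⟪𝟙,⟫ j (M i) ⟩
    M i j                    ∎

  ⊡-zeroˡ : ∀ {M N : Mat n} → (∀ i j → M i j ≈ 0#) → ∀ i j → (M ⊡ N) i j ≈ 0#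
  ⊡-zeroˡ {N = N} M≈0 i j = sum-zero (λ k → trans (*-congʳ {x = N k j} (M≈0 i k)) (zeroˡ (N k j)))

  ⊡-zeroʳ : ∀ {M N : Mat n} → (∀ i j → N i j ≈ 0#) → ∀ i j → (M ⊡ N) i j ≈ 0#
  ⊡-zeroʳ {M = M} N≈0 i j = sum-zero (λ k → trans (*-congˡ {x = M i k} (N≈0 k j)) (zeroʳ (M i k)))

  ⊡-sym : ∀ {M N : Mat n} → Sym M → Sym N → ∀ i j → (M ⊡ N) i j ≈ (N ⊡ M) j i
  ⊡-sym {M = M} {N} M-sym N-sym i j = begin
    ⟪ M i , (λ k → N k j) ⟫  ≈⟨ ⟪⟫-cong (λ k → M-sym i k) (λ k → N-sym k j) ⟩
    ⟪ (λ k → M k i) , N j ⟫  ≈⟨ ⟪⟫-comm (λ k → M k i) (N j) ⟩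
    ⟪ N j , (λ k → M k i) ⟫  ∎

  ⋆-adjoint : ∀ {M : Mat n} → Sym M → ∀ x y → ⟪ x , M ⋆ y ⟫ ≈ ⟪ M ⋆ x , y ⟫
  ⋆-adjoint {M = M} M-sym x y = begin
    ⟪ x , M ⋆ y ⟫                        ≈⟨ ⟪⟫-assoc x M y ⟨
    ⟪ (λ j → ⟪ x , (λ i → M i j) ⟫) , y ⟫
      ≈⟨ ⟪⟫-congʳ (λ j → trans (⟪⟫-congˡ (λ i → M-sym i j)) (⟪⟫-comm x (M j))) ⟩
    ⟪ M ⋆ x , y ⟫                        ∎

  ⋆-+* : ∀ (M : Mat n) x a y i → (M ⋆ (λ k → x k + a * y k)) i ≈ (M ⋆ x) i + a * (M ⋆ y) i
  ⋆-+* M x a y i = ⟪⟫-+*ʳ (M i) x a y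

  form-+* : ∀ {M : Mat n} → Sym M → ∀ x a y → let z = λ k → x k + a * y k in
            ⟪ z , M ⋆ z ⟫ ≈ ⟪ x , M ⋆ x ⟫ + a * (⟪ x , M ⋆ y ⟫ + ⟪ x , M ⋆ y ⟫) + a * a * ⟪ y , M ⋆ y ⟫
  form-+* {M = M} M-sym x a y = let z = λ k → x k + a * y k in begin
    ⟪ z , M ⋆ z ⟫
      ≈⟨ ⟪⟫-congˡ (⋆-+* M x a y) ⟩
    ⟪ z , (λ k → (M ⋆ x) k + a * (M ⋆ y) k) ⟫
      ≈⟨ ⟪⟫-+*ʳ z (M ⋆ x) a (M ⋆ y) ⟩
    ⟪ z , M ⋆ x ⟫ + a * ⟪ z , M ⋆ y ⟫
      ≈⟨ +-cong (⟪⟫-+*ˡ x a y (M ⋆ x)) (*-congˡ (⟪⟫-+*ˡ x a y (M ⋆ y))) ⟩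
    (⟪ x , M ⋆ x ⟫ + a * ⟪ y , M ⋆ x ⟫) + a * (⟪ x , M ⋆ y ⟫ + a * ⟪ y , M ⋆ y ⟫)
      ≈⟨ +-congʳ (+-congˡ (*-congˡ (trans (⋆-adjoint M-sym y x) (⟪⟫-comm (M ⋆ y) x)))) ⟩
    (⟪ x , M ⋆ x ⟫ + a * ⟪ x , M ⋆ y ⟫) + a * (⟪ x , M ⋆ y ⟫ + a * ⟪ y , M ⋆ y ⟫)
      ≈⟨ solve 4 (λ p q r a → (p :+ a :* q) :+ a :* (q :+ a :* r)
                            := p :+ a :* (q :+ q) :+ a :* a :* r) refl _ _ _ a ⟩
    ⟪ x , M ⋆ x ⟫ + a * (⟪ x , M ⋆ y ⟫ + ⟪ x , M ⋆ y ⟫) + a * a * ⟪ y , M ⋆ y ⟫ ∎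

  form-basis : ∀ (M : Mat n) i j → ⟪ 𝟙 i , M ⋆ 𝟙 j ⟫ ≈ M i j
  form-basis M i j = trans (⟪𝟙,⟫ i (M ⋆ 𝟙 j)) (trans (⟪⟫-comm (M i) (𝟙 j)) (⟪𝟙,⟫ j (M i)))

  -- The products `x i * (N i j * x j)` are bounded one by one, and `b` adds up the crude factors
  -- `N i j * N i j + 1#`.
  form-bounded : ∀ (N : Mat n) → ∃[ b ] 0# ≤ b × (∀ x → ⟪ x , N ⋆ x ⟫ ≤ b * ⟪ x , x ⟫)
  form-bounded N = b , sum-nonNegative (λ i → sum-nonNegative (λ j → 0≤bound i j)) , λ x →
    ≤-respʳ-≈ (sym (trans (*-distribʳ-sum ⟪ x , x ⟫ (λ i → sum (bound i)))
                          (sum-cong-≋ (λ i → *-distribʳ-sum ⟪ x , x ⟫ (bound i)))))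
      (sum-mono-≤ (λ i → ≤-respˡ-≈ (sym (*-distribˡ-sum (x i) (λ j → N i j * x j)))
        (sum-mono-≤ (λ j → term x i j))))
    where
    bound : _ → _ → Carrier
    bound i j = N i j * N i j + 1#
    b : Carrier
    b = sum (λ i → sum (λ j → bound i j))
    0≤bound : ∀ i j → 0# ≤ bound i j
    0≤bound i j = +-nonNegative (square-nonNegative (N i j)) 0≤1
    -- a N b ≤ N² a² + b², because twice the difference is a sum of squares.
    term : ∀ x i j → x i * (N i j * x j) ≤ bound i j * ⟪ x , x ⟫
    term x i j = 0≤y-x⇒x≤y (≤-respʳ-≈
      (solve 4 (λ a b N s → (N :* N :* (s :- a :* a) :+ (s :- b :* b)) :+ (N :* N :* (a :* a) :+ b :* b :- a :* (N :* b))
                          := (N :* N :+ :1) :* s :- a :* (N :* b)) refl (x i) (x j) (N i j) ⟪ x , x ⟫)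
      (+-nonNegative
        (+-nonNegative (*-nonNegative (square-nonNegative (N i j)) (x≤y⇒0≤y-x (coordinate i)))
                       (x≤y⇒0≤y-x (coordinate j)))
        (halve-nonNegative (≤-respʳ-≈
          (solve 3 (λ a b N → (N :* a :- b) :* (N :* a :- b) :+ ((N :* a) :* (N :* a) :+ b :* b)
                            := (N :* N :* (a :* a) :+ b :* b :- a :* (N :* b)) :+ (N :* N :* (a :* a) :+ b :* b :- a :* (N :* b)))
             refl (x i) (x j) (N i j))
          (+-nonNegative (square-nonNegative _) (+-nonNegative (square-nonNegative _) (square-nonNegative _)))))))
      where
      coordinate : ∀ k → x k * x k ≤ ⟪ x , x ⟫
      coordinate k = term≤sum (λ k → square-nonNegative (x k)) k

  -- Polynomials in a matrix

  infix 5 _at_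
  -- Horner evaluation at `M` of the polynomial with coefficients `c`, constant term first. Thus
  -- `c ∘ suc` is the quotient on division by the variable.
  _at_ : ∀ {d} → Vector Carrier d → Mat n → Mat n
  _at_ {d = zero}  c M i j = 0#
  _at_ {d = suc d} c M i j = c zero * 𝟙 i j + ((c ∘ suc at M) ⊡ M) i j

  power : Mat n → ℕ → Mat n
  power M zero    = 𝟙
  power M (suc k) = power M k ⊡ M

  at-sum : ∀ {d} (c : Vector Carrier d) (M : Mat n) i j → (c at M) i j ≈ sum (λ k → c k * power M (toℕ k) i j)
  at-sum {d = zero}  c M i j = refl
  at-sum {d = suc d} c M i j = +-congˡ (begin
    sum (λ l → (c ∘ suc at M) i l * M l j)
      ≈⟨ ⟪⟫-congʳ (at-sum (c ∘ suc) M i) ⟩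
    ⟪ (λ l → ⟪ c ∘ suc , (λ k → power M (toℕ k) i l) ⟫) , (λ l → M l j) ⟫
      ≈⟨ ⟪⟫-assoc (c ∘ suc) (λ k l → power M (toℕ k) i l) (λ l → M l j) ⟩
    ⟪ c ∘ suc , (λ k → power M (suc (toℕ k)) i j) ⟫ ∎)

  at-scale : ∀ {d} a (c : Vector Carrier d) (M : Mat n) i j → ((λ k → a * c k) at M) i j ≈ a * (c at M) i j
  at-scale a c M i j = begin
    ((λ k → a * c k) at M) i j                        ≈⟨ at-sum (λ k → a * c k) M i j ⟩
    sum (λ k → a * c k * power M (toℕ k) i j)         ≈⟨ sum-cong-≋ (λ k → *-assoc a (c k) (power M (toℕ k) i j)) ⟩
    sum (λ k → a * (c k * power M (toℕ k) i j))       ≈⟨ *-distribˡ-sum a (λ k → c k * power M (toℕ k) i j) ⟨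
    a * sum (λ k → c k * power M (toℕ k) i j)         ≈⟨ *-congˡ (at-sum c M i j) ⟨
    a * (c at M) i j                                  ∎

  at-commutes : ∀ {d} (c : Vector Carrier d) (M : Mat n) i j → (M ⊡ (c at M)) i j ≈ ((c at M) ⊡ M) i j
  at-commutes {d = zero}  c M i j = trans (⊡-zeroʳ {M = M} (λ _ _ → refl) i j) (sym (⊡-zeroˡ {N = M} (λ _ _ → refl) i j))
  at-commutes {d = suc d} c M i j = begin
    ⟪ M i , (λ k → c zero * 𝟙 k j + (P ⊡ M) k j) ⟫
      ≈⟨ ⟪⟫-congˡ {x = M i} (λ k → +-comm (c zero * 𝟙 k j) ((P ⊡ M) k j)) ⟩
    ⟪ M i , (λ k → (P ⊡ M) k j + c zero * 𝟙 k j) ⟫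
      ≈⟨ ⟪⟫-+*ʳ (M i) (λ k → (P ⊡ M) k j) (c zero) (λ k → 𝟙 k j) ⟩
    (M ⊡ (P ⊡ M)) i j + c zero * (M ⊡ 𝟙) i j
      ≈⟨ +-cong (trans (sym (⊡-assoc M P M i j)) (⊡-congʳ M (at-commutes (c ∘ suc) M) i j))
           (*-congˡ (trans (⊡-identityʳ M i j) (sym (⊡-identityˡ M i j)))) ⟩
    ((P ⊡ M) ⊡ M) i j + c zero * (𝟙 ⊡ M) i j
      ≈⟨ ⟪⟫-+*ˡ ((P ⊡ M) i) (c zero) (𝟙 i) (λ k → M k j) ⟨
    ⟪ (λ k → (P ⊡ M) i k + c zero * 𝟙 i k) , (λ k → M k j) ⟫
      ≈⟨ ⟪⟫-congʳ {y = λ k → M k j} (λ k → +-comm ((P ⊡ M) i k) (c zero * 𝟙 i k)) ⟩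
    ((c at M) ⊡ M) i j ∎
    where P = c ∘ suc at M

  at-sym : ∀ {d} (c : Vector Carrier d) {M : Mat n} → Sym M → Sym (c at M)
  at-sym {d = zero}  c     M-sym i j = refl
  at-sym {d = suc d} c {M} M-sym i j = +-cong (*-congˡ (𝟙-sym i j)) (begin
    ((c ∘ suc at M) ⊡ M) i j  ≈⟨ ⊡-sym (at-sym (c ∘ suc) M-sym) M-sym i j ⟩
    (M ⊡ (c ∘ suc at M)) j i  ≈⟨ at-commutes (c ∘ suc) M j i ⟩
    ((c ∘ suc at M) ⊡ M) j i  ∎)

  -- The first `suc (n ℕ.* n)` powers of `M`, read as vectors with `n ℕ.* n` entries, are linearly
  -- dependent.
  annihilator : ∀ (M : Mat n) → ∃[ d ] ∃ λ (c : Vector Carrier d) →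
                (∃[ k ] ¬ (c k ≈ 0#)) × (∀ i j → (c at M) i j ≈ 0#)
  annihilator {n} M
    with linearDependence (n ℕ.* n) (λ k x → power M (toℕ k) (proj₁ (remQuot {n} n x)) (proj₂ (remQuot {n} n x)))
  ... | c , c≉0 , rel = _ , c , c≉0 , λ i j → begin
    (c at M) i j
      ≈⟨ at-sum c M i j ⟩
    sum (λ k → c k * power M (toℕ k) i j)
      ≡⟨ ≡.cong (λ (i , j) → sum (λ k → c k * power M (toℕ k) i j)) (Fin.remQuot-combine i j) ⟨
    sum (λ k → c k * power M (toℕ k) (proj₁ (remQuot {n} n (combine i j))) (proj₂ (remQuot {n} n (combine i j))))
      ≈⟨ rel (combine i j) ⟩
    0# ∎

  -- A real symmetric matrix is semisimple.
  ⊡-cancelʳ : ∀ {M : Mat n} → Sym M → ∀ (P : Mat n) → (∀ i j → ((P ⊡ M) ⊡ M) i j ≈ 0#) → ∀ i j → (P ⊡ M) i j ≈ 0#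
  ⊡-cancelʳ {M = M} M-sym P PMM≈0 i = ⟪x,x⟫≈0⇒x≈0 r (begin
    ⟪ r , r ⟫                          ≈⟨ ⟪⟫-assoc (P i) M r ⟩
    ⟪ P i , (λ k → ⟪ M k , r ⟫) ⟫      ≈⟨ sum-zero (λ k → trans (*-congˡ {x = P i k} (Mr≈0 k)) (zeroʳ (P i k))) ⟩
    0#                                 ∎)
    where
    r = (P ⊡ M) i
    Mr≈0 : ∀ k → ⟪ M k , r ⟫ ≈ 0#
    Mr≈0 k = trans (⟪⟫-comm (M k) r) (trans (⟪⟫-congˡ (λ l → M-sym k l)) (PMM≈0 i k))

  private
    -- If the constant coefficient vanishes, `c at M` is `(c ∘ suc at M) ⊡ M`, and `⊡-cancelʳ`
    -- removes one of the two factors `M` that now follow. The trailing factor `M` is carried along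
    -- to make this possible, and the nonzero coefficient ends the descent.
    stripZeros : ∀ {d} {M : Mat n} → Sym M → (c : Vector Carrier d) → (∃[ k ] ¬ (c k ≈ 0#)) →
                 (∀ i j → ((c at M) ⊡ M) i j ≈ 0#) →
                 ∃[ d′ ] ∃ λ (c′ : Vector Carrier (suc d′)) →
                 ¬ (c′ zero ≈ 0#) × (∀ i j → ((c′ at M) ⊡ M) i j ≈ 0#)
    stripZeros {d = suc d} {M} M-sym c (k , ck≉0) cMM≈0 with c zero ≟ 0#
    ... | no  c₀≉0 = d , c , c₀≉0 , cMM≈0
    ... | yes c₀≈0 with k
    ...   | zero  = contradiction c₀≈0 ck≉0
    ...   | suc k = stripZeros M-sym (c ∘ suc) (k , ck≉0) (⊡-cancelʳ M-sym (c ∘ suc at M) (λ i j → begin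
      (((c ∘ suc at M) ⊡ M) ⊡ M) i j  ≈⟨ ⊡-congʳ M (λ i j → trans
                                           (+-congʳ {((c ∘ suc at M) ⊡ M) i j} (trans (*-congʳ c₀≈0) (zeroˡ (𝟙 i j))))
                                           (+-identityˡ _)) i j ⟨
      ((c at M) ⊡ M) i j              ≈⟨ cMM≈0 i j ⟩
      0#                              ∎))

  -- Division by the constant coefficient makes it one. The polynomial then acts as the identity on
  -- the kernel of `M`, while its product with `M` vanishes, so its value is the projection onto
  -- that kernel.
  kernelPolynomial : ∀ {M : Mat n} → Sym M → ∃[ d ] ∃ λ (h : Vector Carrier d) →
                     ∀ i j → (((1# ∷ h) at M) ⊡ M) i j ≈ 0#
  kernelPolynomial {M = M} M-sym with annihilator M
  ... | _ , c , c≉0 , cM≈0 with stripZeros M-sym c c≉0 (⊡-zeroˡ cM≈0)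
  ...   | d , c′ , c₀≉0 , cMM≈0 = d , (λ k → c′ zero ⁻¹ * c′ (suc k)) , λ i j → begin
    (((1# ∷ (λ k → c′ zero ⁻¹ * c′ (suc k))) at M) ⊡ M) i j
      ≈⟨ ⊡-congʳ M (λ i j → +-congʳ {(((λ k → c′ zero ⁻¹ * c′ (suc k)) at M) ⊡ M) i j}
           (*-congʳ {𝟙 i j} (sym (⁻¹-inverseˡ c₀≉0)))) i j ⟩
    (((λ k → c′ zero ⁻¹ * c′ k) at M) ⊡ M) i j
      ≈⟨ ⊡-congʳ M (at-scale (c′ zero ⁻¹) c′ M) i j ⟩
    ((λ i j → c′ zero ⁻¹ * (c′ at M) i j) ⊡ M) i j
      ≈⟨ ⟪⟫-comm _ (λ k → M k j) ⟩
    ⟪ (λ k → M k j) , (λ k → c′ zero ⁻¹ * (c′ at M) i k) ⟫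
      ≈⟨ ⟪⟫-*ʳ (λ k → M k j) (c′ zero ⁻¹) ((c′ at M) i) ⟩
    c′ zero ⁻¹ * ⟪ (λ k → M k j) , (c′ at M) i ⟫
      ≈⟨ *-congˡ (trans (⟪⟫-comm (λ k → M k j) _) (cMM≈0 i j)) ⟩
    c′ zero ⁻¹ * 0#
      ≈⟨ zeroʳ _ ⟩
    0# ∎

-- The least eigenvalue and its eigenprojection

module LeastEigenvalue {c ℓ₁ ℓ₂ : Level} (ℝ : CompleteOrderedField c ℓ₁ ℓ₂) where
  open OrderedField ℝ
  open InnerProducts ℝ
  open Matrices ℝ
  open ≈-Reasoning

  PositiveSemidefinite : ∀ {n} → Mat n → Set _
  PositiveSemidefinite M = ∀ x → 0# ≤ ⟪ x , M ⋆ x ⟫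

  infixl 6 _-𝟙*_
  _-𝟙*_ : ∀ {n} → Mat n → Carrier → Mat n
  (A -𝟙* r) i j = A i j + - r * 𝟙 i j

  -𝟙*-sym : ∀ {n} {A : Mat n} → Sym A → ∀ r → Sym (A -𝟙* r)
  -𝟙*-sym A-sym r i j = +-cong (A-sym i j) (*-congˡ (𝟙-sym i j))

  form-𝟙* : ∀ {n} (A : Mat n) r x → ⟪ x , (A -𝟙* r) ⋆ x ⟫ ≈ ⟪ x , A ⋆ x ⟫ - r * ⟪ x , x ⟫
  form-𝟙* A r x = begin
    ⟪ x , (A -𝟙* r) ⋆ x ⟫
      ≈⟨ ⟪⟫-congˡ (λ i → trans (⟪⟫-+*ˡ (A i) (- r) (𝟙 i) x) (+-congˡ (*-congˡ (𝟙-⋆ x i)))) ⟩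
    ⟪ x , (λ i → (A ⋆ x) i + - r * x i) ⟫
      ≈⟨ ⟪⟫-+*ʳ x (A ⋆ x) (- r) x ⟩
    ⟪ x , A ⋆ x ⟫ + - r * ⟪ x , x ⟫
      ≈⟨ solve 3 (λ q r s → q :+ (:- r) :* s := q :- r :* s) refl _ r _ ⟩
    ⟪ x , A ⋆ x ⟫ - r * ⟪ x , x ⟫ ∎

  -- `E` is given by coefficients because a polynomial in `A` inherits the walk-regularity of the
  -- powers of `A`.
  record LeastEigenprojection {n} (A : Mat n) : Set (c ⊔ ℓ₁ ⊔ ℓ₂) where
    field
      τ           : Carrier
      {degree}    : ℕ
      coefficients : Vector Carrier degree

    E : Mat n
    E = coefficients at A -𝟙* τ

    field
      positiveSemidefinite : PositiveSemidefinite (A -𝟙* τ)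
      annihilates          : ∀ i j → (E ⊡ (A -𝟙* τ)) i j ≈ 0#
      symmetric            : Sym E
      idempotent           : ∀ i j → (E ⊡ E) i j ≈ E i j
      nonzero              : ¬ (∀ i j → E i j ≈ 0#)

  module _ {n} {A : Mat n} (A-sym : Sym A) (v : Fin n) where

    -- Lower bounds of the Rayleigh quotient, stated without division. `Lift` raises the universe
    -- level to the one that `complete` requires.
    LowerBound : Carrier → Set (c ⊔ ℓ₁ ⊔ ℓ₂)
    LowerBound r = Lift ℓ₁ (∀ x → r * ⟪ x , x ⟫ ≤ ⟪ x , A ⋆ x ⟫)

    -- The negative of an upper bound for the form of minus `A`.
    someLowerBound : ∃ LowerBound
    someLowerBound = let b , _ , form≤ = form-bounded (λ i j → - 1# * A i j) in
      - b , lift λ x → 0≤y-x⇒x≤y (≤-respʳ-≈ (begin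
      b * ⟪ x , x ⟫ - ⟪ x , (λ i j → - 1# * A i j) ⋆ x ⟫
        ≈⟨ +-congˡ (-‿cong (trans (⟪⟫-congˡ (λ i → trans (⟪⟫-comm (λ j → - 1# * A i j) x)
             (trans (⟪⟫-*ʳ x (- 1#) (A i)) (*-congˡ (⟪⟫-comm x (A i)))))) (⟪⟫-*ʳ x (- 1#) (A ⋆ x)))) ⟩
      b * ⟪ x , x ⟫ - (- 1# * ⟪ x , A ⋆ x ⟫)
        ≈⟨ solve 3 (λ b s q → b :* s :- (:- :1) :* q := q :- (:- b) :* s) refl b _ _ ⟩
      ⟪ x , A ⋆ x ⟫ - (- b) * ⟪ x , x ⟫ ∎) (x≤y⇒0≤y-x (form≤ x)))

    -- The Rayleigh quotient at the basis vector of `v` is `A v v`.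
    lowerBounds-bounded : ∃ (IsUpperBound LowerBound)
    lowerBounds-bounded = A v v , λ {r} r∈ → ≤-resp₂-≈
      (trans (*-congˡ (trans (⟪𝟙,⟫ v (𝟙 v)) (𝟙-diagonal v))) (*-identityʳ r))
      (form-basis A v v) (lower r∈ (𝟙 v))

    module _ {τ : Carrier} (τ-greatest : IsLeastUpperBound LowerBound τ) where
      private
        M : Mat n
        M = A -𝟙* τ

      M-sym : Sym M
      M-sym = -𝟙*-sym A-sym τ

      -- For `x` of nonzero norm the Rayleigh quotient is an upper bound of all lower bounds, hence
      -- at least the supremum. For norm zero the left side does not depend on the factor, and any
      -- known lower bound will do.
      τ-lowerBound : ∀ x → τ * ⟪ x , x ⟫ ≤ ⟪ x , A ⋆ x ⟫
      τ-lowerBound x = byCases (⟪ x , x ⟫ ≟ 0#)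
        where
        byCases : Dec (⟪ x , x ⟫ ≈ 0#) → τ * ⟪ x , x ⟫ ≤ ⟪ x , A ⋆ x ⟫
        byCases (yes s≈0) = ≤-respˡ-≈ (trans (r*s≈0 (proj₁ someLowerBound)) (sym (r*s≈0 τ)))
                          (lower (proj₂ someLowerBound) x)
          where
          r*s≈0 : ∀ r → r * ⟪ x , x ⟫ ≈ 0#
          r*s≈0 r = trans (*-congˡ s≈0) (zeroʳ r)
        byCases (no s≉0) = ≤-resp₂-≈ (*-comm _ _) quotient (*-monoˡ-≤ (⟪⟫-nonNegative x) τ≤quotient)
          where
          s q : Carrier
          s = ⟪ x , x ⟫
          q = ⟪ x , A ⋆ x ⟫
          quotient : s * (s ⁻¹ * q) ≈ q
          quotient = trans (sym (*-assoc _ _ _)) (trans (*-congʳ (⁻¹-inverseʳ s≉0)) (*-identityˡ q))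
          τ≤quotient : τ ≤ s ⁻¹ * q
          τ≤quotient = proj₂ τ-greatest (λ r∈ → *-cancelˡ-≤ (⟪⟫-nonNegative x) s≉0
            (≤-resp₂-≈ (*-comm _ _) (sym quotient) (lower r∈ x)))

      M-positiveSemidefinite : PositiveSemidefinite M
      M-positiveSemidefinite x = ≤-respʳ-≈ (sym (form-𝟙* A τ x)) (x≤y⇒0≤y-x (τ-lowerBound x))

      -- If H is minus the inverse of M, then positivity of M at x + b⁻¹ H x
      -- bounds M away from zero, which contradicts the choice of τ.
      noNegatedInverse : ∀ (H : Mat n) → ¬ (∀ i j → (M ⊡ H) i j ≈ - 𝟙 i j)
      noNegatedInverse H MH≈-𝟙 = l≉0 (≤-antisym l≤0 0≤l)
        where
        bounded = form-bounded (λ i j → - 1# * H i j)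
        b = proj₁ bounded
        0≤b = proj₁ (proj₂ bounded)
        form≤ = proj₂ (proj₂ bounded)
        0≤b+1 : 0# ≤ b + 1#
        0≤b+1 = +-nonNegative 0≤b 0≤1
        b+1≉0 : ¬ (b + 1# ≈ 0#)
        b+1≉0 = 1≤x⇒x≉0 (≤-respˡ-≈ (+-identityˡ 1#) (+-monoˡ-≤ 1# 0≤b))
        -- The factor in front of `H ⋆ x` is the inverse of `b + 1#`, because `b` itself may be
        -- zero.
        l : Carrier
        l = (b + 1#) ⁻¹
        l≉0 : ¬ (l ≈ 0#)
        l≉0 = ⁻¹-≉0 b+1≉0
        0≤l : 0# ≤ l
        0≤l = ⁻¹-nonNegative 0≤b+1 b+1≉0
        l≈ll[b+1] : l ≈ l * l * (b + 1#)
        l≈ll[b+1] = sym (trans (*-assoc l l _) (trans (*-congˡ (⁻¹-inverseˡ b+1≉0)) (*-identityʳ l)))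

        module _ (x : Vector Carrier n) where
          y z : Vector Carrier n
          y = H ⋆ x
          z k = x k + l * y k
          s q t : Carrier
          s = ⟪ x , x ⟫
          q = ⟪ x , M ⋆ x ⟫
          t = ⟪ x , (λ i j → - 1# * H i j) ⋆ x ⟫

          My≈-x : ∀ k → (M ⋆ y) k ≈ - 1# * x k
          My≈-x k = begin
            (M ⋆ H ⋆ x) k                 ≈⟨ ⋆-⊡ M H x k ⟨
            ((M ⊡ H) ⋆ x) k               ≈⟨ ⟪⟫-congʳ {y = x} (λ j → trans (MH≈-𝟙 k j)
                                               (solve 1 (λ a → :- a := (:- :1) :* a) refl (𝟙 k j))) ⟩
            ⟪ (λ j → - 1# * 𝟙 k j) , x ⟫  ≈⟨ trans (⟪⟫-comm _ x) (⟪⟫-*ʳ x (- 1#) (𝟙 k)) ⟩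
            - 1# * ⟪ x , 𝟙 k ⟫            ≈⟨ *-congˡ (trans (⟪⟫-comm x (𝟙 k)) (⟪𝟙,⟫ k x)) ⟩
            - 1# * x k                    ∎

          xMy≈-s : ⟪ x , M ⋆ y ⟫ ≈ - s
          xMy≈-s = trans (⟪⟫-congˡ My≈-x) (trans (⟪⟫-*ʳ x (- 1#) x) (solve 1 (λ s → (:- :1) :* s := :- s) refl s))

          yMy≈t : ⟪ y , M ⋆ y ⟫ ≈ t
          yMy≈t = begin
            ⟪ y , M ⋆ y ⟫                 ≈⟨ ⟪⟫-congˡ {x = y} My≈-x ⟩
            ⟪ y , (λ k → - 1# * x k) ⟫    ≈⟨ ⟪⟫-*ʳ y (- 1#) x ⟩
            - 1# * ⟪ y , x ⟫              ≈⟨ *-congˡ (⟪⟫-comm y x) ⟩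
            - 1# * ⟪ x , y ⟫              ≈⟨ ⟪⟫-*ʳ x (- 1#) y ⟨
            ⟪ x , (λ k → - 1# * y k) ⟫    ≈⟨ ⟪⟫-congˡ {x = x} (λ i → trans (*-congˡ (⟪⟫-comm (H i) x))
                                               (trans (sym (⟪⟫-*ʳ x (- 1#) (H i))) (⟪⟫-comm x _))) ⟩
            t                             ∎

          ls≤q : l * s ≤ q
          -- Three nonnegative terms are added: the form of `M` at `z`, the slack `b * s - t` times
          -- `l * l`, and `l * l * s`. The last one turns `b` into `b + 1#`, so that `l≈ll[b+1]`
          -- applies.
          ls≤q = 0≤y-x⇒x≤y (≤-respʳ-≈ (begin
            ((q + l * (- s + - s) + l * l * t) + l * l * (b * s - t)) + l * l * s
              ≈⟨ solve 5 (λ q l s t b → ((q :+ l :* ((:- s) :+ (:- s)) :+ l :* l :* t) :+ l :* l :* (b :* s :- t)) :+ l :* l :* s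
                   := q :- (l :+ l) :* s :+ (l :* l :* (b :+ :1)) :* s) refl q l s t b ⟩
            q - (l + l) * s + (l * l * (b + 1#)) * s
              ≈⟨ +-congˡ (*-congʳ (sym l≈ll[b+1])) ⟩
            q - (l + l) * s + l * s
              ≈⟨ solve 3 (λ q l s → q :- (l :+ l) :* s :+ l :* s := q :- l :* s) refl q l s ⟩
            q - l * s ∎)
            (+-nonNegative (+-nonNegative
              (≤-respʳ-≈ (trans (form-+* M-sym x l y)
                 (+-cong (+-congˡ (*-congˡ (+-cong xMy≈-s xMy≈-s))) (*-congˡ yMy≈t))) (M-positiveSemidefinite z))
              (*-nonNegative (square-nonNegative l) (x≤y⇒0≤y-x (form≤ x))))
              (*-nonNegative (square-nonNegative l) (⟪⟫-nonNegative x))))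

          [τ+l]s≤ : (τ + l) * s ≤ ⟪ x , A ⋆ x ⟫
          [τ+l]s≤ = ≤-resp₂-≈
            (solve 3 (λ l s τ → l :* s :+ τ :* s := (τ :+ l) :* s) refl l s τ)
            (trans (+-congʳ (form-𝟙* A τ x)) (solve 2 (λ q r → (q :- r) :+ r := q) refl _ _))
            (+-monoˡ-≤ (τ * s) ls≤q)

        l≤0 : l ≤ 0#
        l≤0 = ≤-resp₂-≈ (solve 2 (λ τ l → (τ :+ l) :- τ := l) refl τ l) (-‿inverseʳ τ)
                (+-monoˡ-≤ (- τ) (proj₁ τ-greatest (lift [τ+l]s≤)))

      atGreatest : ∀ {d} (h : Vector Carrier d) → (∀ i j → (((1# ∷ h) at M) ⊡ M) i j ≈ 0#) → LeastEigenprojection A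
      atGreatest h EM≈0 = record
        { τ                    = τ
        ; coefficients         = 1# ∷ h
        ; positiveSemidefinite = M-positiveSemidefinite
        ; annihilates          = EM≈0
        ; symmetric            = at-sym (1# ∷ h) M-sym
        ; idempotent           = idempotent
        ; nonzero              = nonzero
        }
        where
        H E : Mat n
        H = h at M
        E = (1# ∷ h) at M

        HME≈0 : ∀ i j → ((H ⊡ M) ⊡ E) i j ≈ 0#
        HME≈0 i j = trans (⊡-assoc H M E i j)
          (⊡-zeroʳ {M = H} (λ i j → trans (at-commutes (1# ∷ h) M i j) (EM≈0 i j)) i j)

        -- `E` is `𝟙` plus `H ⊡ M`, and `H ⊡ M` annihilates `E`.
        idempotent : ∀ i j → (E ⊡ E) i j ≈ E i j
        idempotent i j = begin
          ⟪ E i , (λ k → E k j) ⟫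
            ≈⟨ ⟪⟫-congʳ {y = λ k → E k j} (λ k → +-comm (1# * 𝟙 i k) ((H ⊡ M) i k)) ⟩
          ⟪ (λ k → (H ⊡ M) i k + 1# * 𝟙 i k) , (λ k → E k j) ⟫
            ≈⟨ ⟪⟫-+*ˡ ((H ⊡ M) i) 1# (𝟙 i) (λ k → E k j) ⟩
          ((H ⊡ M) ⊡ E) i j + 1# * (𝟙 ⊡ E) i j
            ≈⟨ +-cong (HME≈0 i j) (*-congˡ (⊡-identityˡ E i j)) ⟩
          0# + 1# * E i j
            ≈⟨ solve 1 (λ e → :0 :+ :1 :* e := e) refl (E i j) ⟩
          E i j ∎

        -- If `E` were zero, `H ⊡ M` would be minus the identity.
        nonzero : ¬ (∀ i j → E i j ≈ 0#)
        nonzero E≈0 = noNegatedInverse H λ i j → begin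
          (M ⊡ H) i j                ≈⟨ at-commutes h M i j ⟩
          (H ⊡ M) i j                ≈⟨ solve 2 (λ d p → p := (:1 :* d :+ p) :- d) refl (𝟙 i j) ((H ⊡ M) i j) ⟩
          E i j - 𝟙 i j              ≈⟨ +-congʳ (E≈0 i j) ⟩
          0# - 𝟙 i j                 ≈⟨ +-identityˡ _ ⟩
          - 𝟙 i j                    ∎

    leastEigenprojection : LeastEigenprojection A
    leastEigenprojection =
      let τ , τ-greatest = complete LowerBound someLowerBound lowerBounds-bounded
          _ , h , EM≈0   = kernelPolynomial (-𝟙*-sym A-sym τ)
      in atGreatest τ-greatest h EM≈0

-- The optimal coloring from the least eigenspace

module CanonicalColoring {c ℓ₁ ℓ₂ : Level} (ℝ : CompleteOrderedField c ℓ₁ ℓ₂) {n : ℕ} (G : Graph n) where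
  open OrderedField ℝ
  open InnerProducts ℝ
  open Matrices ℝ
  open LeastEigenvalue ℝ
  open ≈-Reasoning
  open Graph G

  A : Mat n
  A = adjacency ℝ G

  A-adjacent : ∀ {i j} → i ∼ j → A i j ≈ 1#
  A-adjacent {i} {j} i∼j = reflexive (≡.cong (λ b → if b then 1# else 0#) (dec-true (i ∼? j) i∼j))

  A-nonadjacent : ∀ {i j} → ¬ (i ∼ j) → A i j ≈ 0#
  A-nonadjacent {i} {j} i≁j = reflexive (≡.cong (λ b → if b then 1# else 0#) (dec-false (i ∼? j) i≁j))

  A-sym : Sym A
  A-sym i j = byCases (i ∼? j)
    where
    byCases : Dec (i ∼ j) → A i j ≈ A j i
    byCases (yes i∼j) = trans (A-adjacent i∼j) (sym (A-adjacent (∼-sym i∼j)))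
    byCases (no  i≁j) = trans (A-nonadjacent i≁j) (sym (A-nonadjacent (i≁j ∘ ∼-sym)))

  A*-cong : ∀ {i j x y} → (i ∼ j → x ≈ y) → A i j * x ≈ A i j * y
  A*-cong {i} {j} {x} {y} x≈y = byCases (i ∼? j)
    where
    byCases : Dec (i ∼ j) → A i j * x ≈ A i j * y
    byCases (yes i∼j) = *-congˡ (x≈y i∼j)
    byCases (no  i≁j) = trans (trans (*-congʳ (A-nonadjacent i≁j)) (zeroˡ x))
                          (sym (trans (*-congʳ (A-nonadjacent i≁j)) (zeroˡ y)))

  A-nonNegative : ∀ i j → 0# ≤ A i j
  A-nonNegative i j = byCases (i ∼? j)
    where
    byCases : Dec (i ∼ j) → 0# ≤ A i j
    byCases (yes i∼j) = ≤-respʳ-≈ (sym (A-adjacent i∼j)) 0≤1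
    byCases (no  i≁j) = ≤-reflexive (sym (A-nonadjacent i≁j))

  A*-mono-≤ : ∀ {i j x y} → (i ∼ j → x ≤ y) → A i j * x ≤ A i j * y
  A*-mono-≤ {i} {j} {x} {y} x≤y = byCases (i ∼? j)
    where
    byCases : Dec (i ∼ j) → A i j * x ≤ A i j * y
    byCases (yes i∼j) = *-monoˡ-≤ (A-nonNegative i j) (x≤y i∼j)
    byCases (no  i≁j) = ≤-reflexive (A*-cong {i} {j} (λ i∼j → contradiction i∼j i≁j))

  infixr 8 A^_
  A^_ : ℕ → Mat n
  A^ ℓ = _^_ ℝ A ℓ

  ConstantOn : Rel (Fin n) 0ℓ → Mat n → Set _
  ConstantOn R X = ∃[ a ] ∀ {i j} → R i j → X i j ≈ a

  WalkRegularOn : Rel (Fin n) 0ℓ → Set _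
  WalkRegularOn R = ∀ ℓ → ConstantOn R (A^ ℓ)

  private
    -- Reads a Schur product identity at an entry where the mask `m` is one.
    maskedConstant : ∀ {x b m} → m ≈ 1# → x * m ≈ b * m → x ≈ b
    maskedConstant {x} {b} m≈1 xm≈bm = begin
      x       ≈⟨ *-identityʳ x ⟨
      x * 1#  ≈⟨ *-congˡ m≈1 ⟨
      x * _   ≈⟨ xm≈bm ⟩
      b * _   ≈⟨ *-congˡ m≈1 ⟩
      b * 1#  ≈⟨ *-identityʳ b ⟩
      b       ∎

  walkRegular-diagonal : OneWalkRegular ℝ G → WalkRegularOn _≡_
  walkRegular-diagonal reg ℓ = let (a , A^ℓ∘I≈) , _ = reg ℓ in
    a , λ { {i} ≡.refl → maskedConstant (𝟙-diagonal i) (A^ℓ∘I≈ i i) }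

  walkRegular-edges : OneWalkRegular ℝ G → WalkRegularOn _∼_
  walkRegular-edges reg ℓ = let _ , (b , A^ℓ∘A≈) = reg ℓ in
    b , λ {i} {j} i∼j → maskedConstant (A-adjacent i∼j) (A^ℓ∘A≈ i j)

  walkRegular-distance2 : TwoWalkRegular ℝ G → WalkRegularOn (Distance G 2)
  walkRegular-distance2 (_ , reg) ℓ = let c₂ , A^ℓ∘A₂≈ = reg ℓ in
    c₂ , λ {i} {j} d → maskedConstant
      (reflexive (≡.cong (λ b → if b then 1# else 0#) (dec-true (distance? G 2 i j) d))) (A^ℓ∘A₂≈ i j)

  -- The factor `A^ ℓ` makes the induction along Horner's rule go through: `(P ⊡ M) ⊡ A^ ℓ` is
  -- `P ⊡ A^ (suc ℓ)` minus `τ` times `P ⊡ A^ ℓ`.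
  at-⊡-constantOn : ∀ {R} → WalkRegularOn R → ∀ τ {d} (h : Vector Carrier d) ℓ → ConstantOn R ((h at A -𝟙* τ) ⊡ A^ ℓ)
  at-⊡-constantOn reg τ {zero}  h ℓ = 0# , λ {i} {j} _ → ⊡-zeroˡ {N = A^ ℓ} (λ _ _ → refl) i j
  at-⊡-constantOn reg τ {suc d} h ℓ =
    let a  , A^ℓ≈   = reg ℓ
        b₀ , PA^ℓ≈  = at-⊡-constantOn reg τ (h ∘ suc) ℓ
        b₁ , PA^sℓ≈ = at-⊡-constantOn reg τ (h ∘ suc) (suc ℓ)
    in (b₁ + - τ * b₀) + h zero * a , λ {i} {j} Rij → begin
      ((h at M) ⊡ A^ ℓ) i j
        ≈⟨ ⟪⟫-congʳ {y = λ k → (A^ ℓ) k j} (λ k → +-comm (h zero * 𝟙 i k) ((P ⊡ M) i k)) ⟩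
      ⟪ (λ k → (P ⊡ M) i k + h zero * 𝟙 i k) , (λ k → (A^ ℓ) k j) ⟫
        ≈⟨ ⟪⟫-+*ˡ ((P ⊡ M) i) (h zero) (𝟙 i) (λ k → (A^ ℓ) k j) ⟩
      ((P ⊡ M) ⊡ A^ ℓ) i j + h zero * (𝟙 ⊡ A^ ℓ) i j
        ≈⟨ +-cong (⊡-assoc P M (A^ ℓ) i j) (*-congˡ (trans (⊡-identityˡ (A^ ℓ) i j) (A^ℓ≈ Rij))) ⟩
      (P ⊡ (M ⊡ A^ ℓ)) i j + h zero * a
        ≈⟨ +-congʳ (⊡-congˡ P (λ k j → trans (⟪⟫-+*ˡ (A k) (- τ) (𝟙 k) (λ l → (A^ ℓ) l j))
                                        (+-congˡ (*-congˡ (⊡-identityˡ (A^ ℓ) k j)))) i j) ⟩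
      ⟪ P i , (λ k → (A^ (suc ℓ)) k j + - τ * (A^ ℓ) k j) ⟫ + h zero * a
        ≈⟨ +-congʳ (⟪⟫-+*ʳ (P i) (λ k → (A^ (suc ℓ)) k j) (- τ) (λ k → (A^ ℓ) k j)) ⟩
      ((P ⊡ A^ (suc ℓ)) i j + - τ * (P ⊡ A^ ℓ) i j) + h zero * a
        ≈⟨ +-congʳ (+-cong (PA^sℓ≈ Rij) (*-congˡ (PA^ℓ≈ Rij))) ⟩
      (b₁ + - τ * b₀) + h zero * a ∎
    where
    M P : Mat n
    M = A -𝟙* τ
    P = h ∘ suc at M

  at-constantOn : ∀ {R} → WalkRegularOn R → ∀ τ {d} (h : Vector Carrier d) → ConstantOn R (h at A -𝟙* τ)
  at-constantOn reg τ h = let a , ≈a = at-⊡-constantOn reg τ h 0 in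
    a , λ {i} {j} Rij → trans (sym (⊡-identityʳ (h at A -𝟙* τ) i j)) (≈a Rij)

  A²≈ : ∀ i j → (A^ 2) i j ≈ ⟪ A i , A j ⟫
  A²≈ i j = ⟪⟫-congˡ {x = A i} (λ k → trans (⊡-identityʳ A k j) (A-sym k j))

  -- Since the entries of `A` are zero or one, the diagonal of `A^ 2` lists the degrees.
  regular : OneWalkRegular ℝ G → ∃[ k ] ∀ i → sum (A i) ≈ k
  regular reg = let k , A²≈k = walkRegular-diagonal reg 2 in
    k , λ i → trans (sum-cong-≋ (λ j → trans (sym (*-identityʳ (A i j)))
      (A*-cong {i} {j} (λ i∼j → sym (A-adjacent i∼j))))) (trans (sym (A²≈ i i)) (A²≈k ≡.refl))

  -- The double sum splits over the coordinates `k`, and each part is the form of `M` at the vector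
  -- of `k`-th coordinates.
  sumGram-nonNegative : ∀ {M : Mat n} → PositiveSemidefinite M → ∀ {d} (q : Fin n → Vector Carrier d) →
                        0# ≤ sum (λ i → ⟪ M i , (λ j → ⟪ q i , q j ⟫) ⟫)
  sumGram-nonNegative {M} psd q = ≤-respʳ-≈ (begin
    sum (λ k → ⟪ (λ i → q i k) , M ⋆ (λ i → q i k) ⟫)
      ≈⟨ ∑-comm (λ k i → q i k * (M ⋆ (λ j → q j k)) i) ⟩
    sum (λ i → ⟪ q i , (λ k → ⟪ M i , (λ j → q j k) ⟫) ⟫)
      ≈⟨ sum-cong-≋ (λ i → trans (⟪⟫-comm (q i) (λ k → ⟪ M i , (λ j → q j k) ⟫))
           (trans (⟪⟫-assoc (M i) q (q i)) (⟪⟫-congˡ {x = M i} (λ j → ⟪⟫-comm (q j) (q i))))) ⟩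
    sum (λ i → ⟪ M i , (λ j → ⟪ q i , q j ⟫) ⟫) ∎)
    (sum-nonNegative (λ k → psd (λ i → q i k)))

  record OptimalColoring : Set (c ⊔ ℓ₁ ⊔ ℓ₂) where
    field
      {t}               : Carrier
      {dimension}       : ℕ
      {p}               : Fin n → Vector Carrier dimension
      chromaticNumber   : IsVectorChromaticNumber ℝ G t
      isVectorColoring  : IsVectorColoring ℝ G t p
      constantDistance2 : ∃[ a ] ∀ {u v} → Distance G 2 u v → ⟪ p u , p v ⟫ ≈ a

  module _ (L : LeastEigenprojection A) where
    open LeastEigenprojection L

    module _ {k e ε : Carrier} {i₀ j₀ : Fin n} (i₀∼j₀ : i₀ ∼ j₀)
             (degree≈k   : ∀ i → sum (A i) ≈ k)
             (E-diagonal : ∀ i → E i i ≈ e)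
             (E-edge     : ∀ {i j} → i ∼ j → E i j ≈ ε) where
      private
        M : Mat n
        M = A -𝟙* τ

        σ : Carrier
        σ = - τ

      -- A symmetric idempotent matrix is the Gram matrix of its own rows.
      E-gram : ∀ i j → ⟪ E i , E j ⟫ ≈ E i j
      E-gram i j = trans (⟪⟫-congˡ {x = E i} (λ k → symmetric j k)) (idempotent i j)

      e≉0 : ¬ (e ≈ 0#)
      e≉0 e≈0 = nonzero (λ i j → ⟪x,x⟫≈0⇒x≈0 (E i) (trans (E-gram i i) (trans (E-diagonal i) e≈0)) j)

      -- A diagonal entry of `E ⊡ A` computed twice: as a sum of `k` edge entries of `E`, and by
      -- `annihilates`.
      εk≈τe : ε * k ≈ τ * e
      εk≈τe = begin
        ε * k
          ≈⟨ *-congˡ (degree≈k i₀) ⟨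
        ε * sum (A i₀)
          ≈⟨ *-distribˡ-sum ε (A i₀) ⟩
        sum (λ j → ε * A i₀ j)
          ≈⟨ sum-cong-≋ (λ j → *-comm ε (A i₀ j)) ⟩
        sum (λ j → A i₀ j * ε)
          ≈⟨ sum-cong-≋ (λ j → A*-cong {i₀} {j} (λ i∼j → sym (E-edge i∼j))) ⟩
        sum (λ j → A i₀ j * E i₀ j)
          ≈⟨ sum-cong-≋ (λ j → trans (*-comm (A i₀ j) (E i₀ j)) (*-congˡ (A-sym i₀ j))) ⟩
        (E ⊡ A) i₀ i₀
          ≈⟨ solve 3 (λ a t e → a := (a :+ (:- t) :* e) :+ t :* e) refl ((E ⊡ A) i₀ i₀) τ e ⟩
        ((E ⊡ A) i₀ i₀ + - τ * e) + τ * e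
          ≈⟨ +-congʳ (+-congˡ (*-congˡ (trans (⊡-identityʳ E i₀ i₀) (E-diagonal i₀)))) ⟨
        ((E ⊡ A) i₀ i₀ + - τ * (E ⊡ 𝟙) i₀ i₀) + τ * e
          ≈⟨ +-congʳ (⟪⟫-+*ʳ (E i₀) (λ j → A j i₀) (- τ) (λ j → 𝟙 j i₀)) ⟨
        (E ⊡ M) i₀ i₀ + τ * e
          ≈⟨ +-congʳ (annihilates i₀ i₀) ⟩
        0# + τ * e
          ≈⟨ +-identityˡ _ ⟩
        τ * e ∎

      M-diagonal : ∀ i → M i i ≈ σ
      M-diagonal i = trans (+-cong (A-nonadjacent (∼-irrefl ≡.refl)) (*-congˡ (𝟙-diagonal i)))
        (trans (+-identityˡ _) (*-identityʳ _))

      M-edge : ∀ {i j} → i ∼ j → M i j ≈ 1#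
      M-edge {i} {j} i∼j = trans (+-cong (A-adjacent i∼j) (trans (*-congˡ (𝟙-offDiagonal (λ i≡j → ∼-irrefl i≡j i∼j))) (zeroʳ (- τ))))
        (+-identityʳ _)

      -- The form of `M` at the difference of the basis vectors of two adjacent vertices is twice
      -- `σ - 1#`.
      1≤σ : 1# ≤ σ
      1≤σ = 0≤y-x⇒x≤y (halve-nonNegative (≤-respʳ-≈ (begin
        ⟪ z , M ⋆ z ⟫
          ≈⟨ form-+* (-𝟙*-sym A-sym τ) (𝟙 i₀) (- 1#) (𝟙 j₀) ⟩
        ⟪ 𝟙 i₀ , M ⋆ 𝟙 i₀ ⟫ + - 1# * (⟪ 𝟙 i₀ , M ⋆ 𝟙 j₀ ⟫ + ⟪ 𝟙 i₀ , M ⋆ 𝟙 j₀ ⟫) + - 1# * - 1# * ⟪ 𝟙 j₀ , M ⋆ 𝟙 j₀ ⟫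
          ≈⟨ +-cong (+-cong (trans (form-basis M i₀ i₀) (M-diagonal i₀)) (*-congˡ (+-cong M≈1 M≈1)))
               (*-congˡ (trans (form-basis M j₀ j₀) (M-diagonal j₀))) ⟩
        σ + - 1# * (1# + 1#) + - 1# * - 1# * σ
          ≈⟨ solve 1 (λ s → s :+ (:- :1) :* (:1 :+ :1) :+ (:- :1) :* (:- :1) :* s := (s :- :1) :+ (s :- :1)) refl σ ⟩
        (σ - 1#) + (σ - 1#) ∎) (positiveSemidefinite z)))
        where
        z : Vector Carrier n
        z k = 𝟙 i₀ k + - 1# * 𝟙 j₀ k
        M≈1 : ⟪ 𝟙 i₀ , M ⋆ 𝟙 j₀ ⟫ ≈ 1#
        M≈1 = trans (form-basis M i₀ j₀) (M-edge i₀∼j₀)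

      0≤σ : 0# ≤ σ
      0≤σ = ≤-trans 0≤1 1≤σ

      σ≉0 : ¬ (σ ≈ 0#)
      σ≉0 = 1≤x⇒x≉0 1≤σ

      -- `t` is the Hoffman value 1 - k/τ, and `γ` is the inner product of the normalised rows of
      -- `E` on an edge.
      T t γ : Carrier
      T = k * σ ⁻¹
      t = 1# + T
      γ = e ⁻¹ * ε

      t-1≈T : t - 1# ≈ T
      t-1≈T = solve 1 (λ T → (:1 :+ T) :- :1 := T) refl T

      0≤T : 0# ≤ T
      0≤T = *-nonNegative (≤-respʳ-≈ (degree≈k i₀) (sum-nonNegative (A-nonNegative i₀))) (⁻¹-nonNegative 0≤σ σ≉0)

      Tγ≈-1 : T * γ ≈ - 1#
      Tγ≈-1 = begin
        (k * σ ⁻¹) * (e ⁻¹ * ε)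
          ≈⟨ solve 4 (λ k s e ε → (k :* s) :* (e :* ε) := (s :* e) :* (ε :* k)) refl k (σ ⁻¹) (e ⁻¹) ε ⟩
        (σ ⁻¹ * e ⁻¹) * (ε * k)
          ≈⟨ *-congˡ εk≈τe ⟩
        (σ ⁻¹ * e ⁻¹) * (τ * e)
          ≈⟨ solve 4 (λ s e′ τ e → (s :* e′) :* (τ :* e) := :- ((s :* (:- τ)) :* (e′ :* e))) refl (σ ⁻¹) (e ⁻¹) τ e ⟩
        - ((σ ⁻¹ * σ) * (e ⁻¹ * e))
          ≈⟨ -‿cong (*-cong (⁻¹-inverseˡ σ≉0) (⁻¹-inverseˡ e≉0)) ⟩
        - (1# * 1#)
          ≈⟨ -‿cong (*-identityˡ 1#) ⟩
        - 1# ∎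

      T-γ≈1 : T * - γ ≈ 1#
      T-γ≈1 = begin
        T * - γ    ≈⟨ solve 2 (λ T γ → T :* (:- γ) := :- (T :* γ)) refl T γ ⟩
        - (T * γ)  ≈⟨ -‿cong Tγ≈-1 ⟩
        - (- 1#)   ≈⟨ solve 1 (λ x → :- (:- x) := x) refl 1# ⟩
        1#         ∎

      t-1≉0 : ¬ (t - 1# ≈ 0#)
      t-1≉0 t-1≈0 = 1≉0 (trans (sym T-γ≈1) (trans (*-congʳ (trans (sym t-1≈T) t-1≈0)) (zeroˡ (- γ))))

      γ≈-[t-1]⁻¹ : γ ≈ - ((t - 1#) ⁻¹)
      γ≈-[t-1]⁻¹ = trans (solve 1 (λ x → x := :- (:- x)) refl γ)
        (-‿cong (⁻¹-unique t-1≉0 (trans (*-congʳ t-1≈T) T-γ≈1)))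

      -- The rows of E have squared norm e, and they are rescaled without square
      -- roots: s has squared norm e⁻¹.
      s : Vector Carrier n
      s k = e ⁻¹ * E i₀ k

      ⟪s,s⟫≈e⁻¹ : ⟪ s , s ⟫ ≈ e ⁻¹
      ⟪s,s⟫≈e⁻¹ = begin
        ⟪ s , s ⟫                        ≈⟨ ⟪⟫-*ʳ s (e ⁻¹) (E i₀) ⟩
        e ⁻¹ * ⟪ s , E i₀ ⟫              ≈⟨ *-congˡ (trans (⟪⟫-comm s (E i₀)) (⟪⟫-*ʳ (E i₀) (e ⁻¹) (E i₀))) ⟩
        e ⁻¹ * (e ⁻¹ * ⟪ E i₀ , E i₀ ⟫)  ≈⟨ *-congˡ (*-congˡ (trans (E-gram i₀ i₀) (E-diagonal i₀))) ⟩
        e ⁻¹ * (e ⁻¹ * e)                ≈⟨ *-congˡ (⁻¹-inverseˡ e≉0) ⟩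
        e ⁻¹ * 1#                        ≈⟨ *-identityʳ _ ⟩
        e ⁻¹                             ∎

      canonical : Fin n → Vector Carrier (n ℕ.* n)
      canonical i = s ⊗ E i

      canonical-gram : ∀ i j → ⟪ canonical i , canonical j ⟫ ≈ e ⁻¹ * E i j
      canonical-gram i j = trans (⟪⟫-⊗ s (E i) (E j)) (*-cong ⟪s,s⟫≈e⁻¹ (E-gram i j))

      canonical-unit : ∀ i → ⟪ canonical i , canonical i ⟫ ≈ 1#
      canonical-unit i = trans (canonical-gram i i) (trans (*-congˡ (E-diagonal i)) (⁻¹-inverseˡ e≉0))

      canonical-edge : ∀ {i j} → i ∼ j → ⟪ canonical i , canonical j ⟫ ≈ γ
      canonical-edge {i} {j} i∼j = trans (canonical-gram i j) (*-congˡ (E-edge i∼j))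

      canonical-isVectorColoring : IsVectorColoring ℝ G t canonical
      canonical-isVectorColoring = record
        { unit = canonical-unit
        ; edge = λ i j i∼j → ≤-reflexive (trans (canonical-edge i∼j) γ≈-[t-1]⁻¹)
        }

      -- `t - 2#` equals `T * (1# + γ)`, and twice `1# + γ` is the squared norm of the sum of two
      -- adjacent unit vectors.
      2≤t : 2# ℝ ≤ t
      2≤t = 0≤y-x⇒x≤y (≤-respʳ-≈ (begin
        T * (1# + γ)        ≈⟨ solve 2 (λ T γ → T :* (:1 :+ γ) := T :+ T :* γ) refl T γ ⟩
        T + T * γ           ≈⟨ +-congˡ Tγ≈-1 ⟩
        T - 1#              ≈⟨ solve 1 (λ T → T :- :1 := (:1 :+ T) :- (:1 :+ :1)) refl T ⟩
        t - 2# ℝ            ∎) (*-nonNegative 0≤T (halve-nonNegative (≤-respʳ-≈ (begin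
          ⟪ z , z ⟫
            ≈⟨ norm²-+* (canonical i₀) 1# (canonical j₀) ⟩
          ⟪ canonical i₀ , canonical i₀ ⟫ + 1# * (⟪ canonical i₀ , canonical j₀ ⟫ + ⟪ canonical i₀ , canonical j₀ ⟫)
            + 1# * 1# * ⟪ canonical j₀ , canonical j₀ ⟫
            ≈⟨ +-cong (+-cong (canonical-unit i₀) (*-congˡ (+-cong (canonical-edge i₀∼j₀) (canonical-edge i₀∼j₀))))
                 (*-congˡ (canonical-unit j₀)) ⟩
          1# + 1# * (γ + γ) + 1# * 1# * 1#
            ≈⟨ solve 1 (λ γ → :1 :+ :1 :* (γ :+ γ) :+ :1 :* :1 :* :1 := (:1 :+ γ) :+ (:1 :+ γ)) refl γ ⟩
          (1# + γ) + (1# + γ) ∎) (⟪⟫-nonNegative z)))))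
        where
        z : Vector Carrier (n ℕ.* n)
        z k = canonical i₀ k + 1# * canonical j₀ k

      -- Pair `M` with the Gram matrix of a competing coloring `q`. In each row the diagonal
      -- contributes `σ` and the neighbours together at most `- (k * r)`. As the total is
      -- nonnegative, `k * r ≤ σ`, which rearranges to `T ≤ s - 1#`.
      t-minimal : ∀ {s} → 2# ℝ ≤ s → VectorColorable ℝ G s → t ≤ s
      t-minimal {s} 2≤s (d , q , coloring) = 0≤y-x⇒x≤y (≤-respʳ-≈
        (solve 2 (λ s T → (s :- :1) :- T := s :- (:1 :+ T)) refl s T)
        (x≤y⇒0≤y-x (*-cancelˡ-≤ 0≤σ σ≉0 (≤-resp₂-≈ kr[s-1]≈σT (*-comm (s - 1#) σ) (*-monoˡ-≤ 0≤s-1 kr≤σ)))))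
        where
        open IsVectorColoring coloring
        r : Carrier
        r = (s - 1#) ⁻¹

        1≤s-1 : 1# ≤ s - 1#
        1≤s-1 = 0≤y-x⇒x≤y (≤-respʳ-≈ (solve 1 (λ s → s :- (:1 :+ :1) := (s :- :1) :- :1) refl s) (x≤y⇒0≤y-x 2≤s))

        0≤s-1 : 0# ≤ s - 1#
        0≤s-1 = ≤-trans 0≤1 1≤s-1

        row≤ : ∀ i → ⟪ M i , (λ j → ⟪ q i , q j ⟫) ⟫ ≤ σ - k * r
        row≤ i = ≤-resp₂-≈ (sym (begin
          ⟪ M i , g ⟫                         ≈⟨ ⟪⟫-+*ˡ (A i) (- τ) (𝟙 i) g ⟩
          ⟪ A i , g ⟫ + - τ * ⟪ 𝟙 i , g ⟫     ≈⟨ +-congˡ (*-congˡ (trans (⟪𝟙,⟫ i g) (unit i))) ⟩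
          ⟪ A i , g ⟫ + - τ * 1#              ≈⟨ +-congˡ (*-identityʳ σ) ⟩
          ⟪ A i , g ⟫ + σ                     ∎))
          (begin
          sum (λ j → A i j * - r) + σ         ≈⟨ +-congʳ (*-distribʳ-sum (- r) (A i)) ⟨
          sum (A i) * - r + σ                 ≈⟨ +-congʳ (*-congʳ (degree≈k i)) ⟩
          k * - r + σ                         ≈⟨ solve 3 (λ k r σ → k :* (:- r) :+ σ := σ :- k :* r) refl k r σ ⟩
          σ - k * r                           ∎)
          (+-monoˡ-≤ σ (sum-mono-≤ (λ j → A*-mono-≤ {i} {j} (edge i j))))
          where
          g : Vector Carrier n
          g j = ⟪ q i , q j ⟫

        kr≤σ : k * r ≤ σ
        kr≤σ = 0≤y-x⇒x≤y (sum-constant-nonNegative i₀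
          (≤-trans (sumGram-nonNegative positiveSemidefinite q) (sum-mono-≤ row≤)))

        kr[s-1]≈σT : (s - 1#) * (k * r) ≈ σ * T
        kr[s-1]≈σT = begin
          (s - 1#) * (k * r)  ≈⟨ solve 3 (λ s k r → s :* (k :* r) := k :* (s :* r)) refl (s - 1#) k r ⟩
          k * ((s - 1#) * r)  ≈⟨ *-congˡ (⁻¹-inverseʳ (1≤x⇒x≉0 1≤s-1)) ⟩
          k * 1#              ≈⟨ *-congˡ (⁻¹-inverseʳ σ≉0) ⟨
          k * (σ * σ ⁻¹)      ≈⟨ solve 3 (λ k σ τ → k :* (σ :* τ) := σ :* (k :* τ)) refl k σ (σ ⁻¹) ⟩
          σ * (k * σ ⁻¹)      ∎

      canonical-optimal : ∀ {a} → (∀ {u v} → Distance G 2 u v → E u v ≈ a) → OptimalColoring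
      canonical-optimal {a} E-distance = record
        { chromaticNumber    = (2≤t , _ , canonical , canonical-isVectorColoring) , t-minimal
        ; isVectorColoring   = canonical-isVectorColoring
        ; constantDistance2  = e ⁻¹ * a , λ {u} {v} d → trans (canonical-gram u v) (*-congˡ (E-distance d))
        }

  optimalColoring : TwoWalkRegular ℝ G → ∀ {i j} → i ∼ j → OptimalColoring
  optimalColoring reg {i} i∼j = fromEigenprojection (leastEigenprojection A-sym i)
    where
    fromEigenprojection : LeastEigenprojection A → OptimalColoring
    fromEigenprojection L =
      canonical-optimal L i∼j (proj₂ (regular (proj₁ reg)))
        (λ v → proj₂ (at-constantOn (walkRegular-diagonal (proj₁ reg)) τ coefficients) {v} ≡.refl)
        (proj₂ (at-constantOn (walkRegular-edges (proj₁ reg)) τ coefficients))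
        (proj₂ (at-constantOn (walkRegular-distance2 reg) τ coefficients))
      where open LeastEigenprojection L

-- Idempotent powers of a self-map of a finite set

module _ {n : ℕ} (φ : Fin n → Fin n) where

  iterate : ℕ → Fin n → Fin n
  iterate zero    x = x
  iterate (suc k) x = φ (iterate k x)

  iterate-+ : ∀ k l x → iterate (k ℕ.+ l) x ≡ iterate k (iterate l x)
  iterate-+ zero    l x = ≡.refl
  iterate-+ (suc k) l x = ≡.cong φ (iterate-+ k l x)

  module _ {x : Fin n} {i p : ℕ} (periodic : iterate (p ℕ.+ i) x ≡ iterate i x) where
    open ≡.≡-Reasoning

    iterate-*-period : ∀ q → iterate (q ℕ.* p ℕ.+ i) x ≡ iterate i x
    iterate-*-period zero    = ≡.refl
    iterate-*-period (suc q) = begin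
      iterate ((p ℕ.+ q ℕ.* p) ℕ.+ i) x         ≡⟨ ≡.cong (λ k → iterate k x) (ℕ.+-assoc p _ i) ⟩
      iterate (p ℕ.+ (q ℕ.* p ℕ.+ i)) x         ≡⟨ iterate-+ p _ x ⟩
      iterate p (iterate (q ℕ.* p ℕ.+ i) x)     ≡⟨ ≡.cong (iterate p) (iterate-*-period q) ⟩
      iterate p (iterate i x)                   ≡⟨ iterate-+ p i x ⟨
      iterate (p ℕ.+ i) x                       ≡⟨ periodic ⟩
      iterate i x                               ∎

    -- Beyond the preperiod `i`, further steps by a multiple of the period `p` change nothing, and
    -- `m` is itself such a multiple.
    iterate-multiple-idempotent : ∀ {m} → p ∣ m → i ℕ.≤ m → iterate m (iterate m x) ≡ iterate m x
    iterate-multiple-idempotent {m} (divides q ≡.refl) i≤m = begin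
      iterate m (iterate m x)                     ≡⟨ iterate-+ m m x ⟨
      iterate (m ℕ.+ m) x                         ≡⟨ ≡.cong (λ k → iterate (m ℕ.+ k) x) (ℕ.m∸n+n≡m i≤m) ⟨
      iterate (m ℕ.+ (m ℕ.∸ i ℕ.+ i)) x           ≡⟨ ≡.cong (λ k → iterate k x) (ℕ.+-assoc m (m ℕ.∸ i) i) ⟨
      iterate ((m ℕ.+ (m ℕ.∸ i)) ℕ.+ i) x         ≡⟨ ≡.cong (λ k → iterate (k ℕ.+ i) x) (ℕ.+-comm m _) ⟩
      iterate (((m ℕ.∸ i) ℕ.+ m) ℕ.+ i) x         ≡⟨ ≡.cong (λ k → iterate k x) (ℕ.+-assoc (m ℕ.∸ i) m i) ⟩
      iterate ((m ℕ.∸ i) ℕ.+ (m ℕ.+ i)) x         ≡⟨ iterate-+ (m ℕ.∸ i) _ x ⟩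
      iterate (m ℕ.∸ i) (iterate (m ℕ.+ i) x)     ≡⟨ ≡.cong (iterate (m ℕ.∸ i)) (iterate-*-period q) ⟩
      iterate (m ℕ.∸ i) (iterate i x)             ≡⟨ iterate-+ (m ℕ.∸ i) i x ⟨
      iterate (m ℕ.∸ i ℕ.+ i) x                   ≡⟨ ≡.cong (λ k → iterate k x) (ℕ.m∸n+n≡m i≤m) ⟩
      iterate m x                                 ∎

  -- Some power of an endomap is idempotent: the preperiods are at most n and
  -- the periods divide n !.
  exponent : ℕ
  exponent = suc n ℕ.* n !

  iterate-exponent-idempotent : ∀ x → iterate exponent (iterate exponent x) ≡ iterate exponent x
  iterate-exponent-idempotent x
    -- Two of the first `suc n` iterates coincide: the smaller index serves as preperiod, the
    -- difference of the indices as period.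
    with i , j , i<j , eq ← pigeonhole (ℕ.n<1+n n) (λ k → iterate (toℕ k) x) =
    iterate-multiple-idempotent {i = toℕ i} {p = toℕ j ℕ.∸ toℕ i}
      (≡.trans (≡.cong (λ k → iterate k x) (ℕ.m∸n+n≡m (ℕ.<⇒≤ i<j))) (≡.sym eq))
      (∣-trans (positive∣! (ℕ.m<n⇒0<n∸m i<j)) (∣-trans (m≤n⇒m!∣n! p≤n) (n∣m*n (suc n))))
      (ℕ.≤-trans (ℕ.<⇒≤ (toℕ<n i)) (ℕ.m≤m*n (suc n) (n !) {{n ℕ.!≢0}}))
    where
    positive∣! : ∀ {k} → 0 ℕ.< k → k ∣ k !
    positive∣! {suc k} _ = divides (k !) (ℕ.*-comm (suc k) (k !))
    p≤n : toℕ j ℕ.∸ toℕ i ℕ.≤ n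
    p≤n = ℕ.≤-trans (ℕ.m∸n≤m (toℕ j) (toℕ i)) (ℕ.≤-pred (toℕ<n j))

funToFin-cong : ∀ {m n} {f g : Fin m → Fin n} → (∀ i → f i ≡ g i) → funToFin f ≡ funToFin g
funToFin-cong {zero}  f≗g = ≡.refl
funToFin-cong {suc m} f≗g = ≡.cong₂ combine (f≗g zero) (funToFin-cong (f≗g ∘ suc))

-- Connectedness, graph structure from an equivalence, and cores

module _ {n : ℕ} (G : Graph n) where
  open Graph G

  Closed : ∀ {ℓ} → Pred (Fin n) ℓ → Set _
  Closed P = ∀ {u v} → u ∼ v → P u → P v

  -- Connectedness without walks: no decidable set of vertices is a union of
  -- components, except for the empty and the full one.
  Connected : Set
  Connected = ∀ (S : Fin n → Bool) → (∀ {u v} → u ∼ v → S u ≡ S v) → ∀ u v → S u ≡ S v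

  -- Connectedness as an induction principle: adjacency is symmetric, so a closed decidable property
  -- has the same truth value at both ends of every edge.
  spread : Connected → ∀ {ℓ} {P : Pred (Fin n) ℓ} → Unary.Decidable P → Closed P → ∀ {u} → P u → ∀ v → P v
  spread connected P? closed {u} Pu v with P? v | connected (does ∘ P?) (λ {u} {v} u∼v →
    does-⇔ (mk⇔ (closed u∼v) (closed (∼-sym u∼v))) (P? u) (P? v)) v u
  ... | yes Pv | _     = Pv
  ... | no  _  | false≡ = contradiction (≡.trans false≡ (dec-true (P? u) Pu)) λ ()

  -- The equivalence stands for equality of the vectors of a coloring. Edges join different classes,
  -- while the ends of an induced path of length two share a class.
  module TwoStepRelation
    (connected : Connected)
    {ℓ} {_≈_ : Rel (Fin n) ℓ} (isDecEquivalence : IsDecEquivalence _≈_)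
    (edge⇒≉ : ∀ {u v} → u ∼ v → ¬ (u ≈ v))
    (twoStep : ∀ {x y z} → x ∼ y → y ∼ z → ¬ (x ∼ z) → x ≈ z)
    where
    open IsDecEquivalence isDecEquivalence

    -- One side is the class of `v₀`. Without triangles every walk of length two stays in its class,
    -- so along each edge the walk alternates between this class and vertices whose neighbours all
    -- lie in it.
    triangleFree⇒bipartite : Fin n → (∀ {x y z} → x ∼ y → y ∼ z → ¬ (x ∼ z)) → Bipartite G
    triangleFree⇒bipartite v₀ triangleFree = side , opposite
      where
      Invariant : Fin n → Set _
      Invariant x = x ≈ v₀ ⊎ (∀ y → x ∼ y → y ≈ v₀)

      invariant : ∀ x → Invariant x
      invariant = spread connected
        (λ x → (x ≟ v₀) ⊎-dec all? (λ y → (x ∼? y) →-dec (y ≟ v₀)))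
        (λ { x∼y (inj₁ x≈v₀) → inj₂ (λ z y∼z → trans (sym (twoStep x∼y y∼z (triangleFree x∼y y∼z))) x≈v₀)
           ; x∼y (inj₂ near) → inj₁ (near _ x∼y) })
        (inj₁ refl)

      side : Fin n → Fin 2
      side x = if does (x ≟ v₀) then zero else suc zero

      opposite : ∀ u v → u ∼ v → side u ≢ side v
      opposite u v u∼v su≡sv with u ≟ v₀ | v ≟ v₀ | invariant u
      ... | yes u≈v₀ | yes v≈v₀ | _         = edge⇒≉ u∼v (trans u≈v₀ (sym v≈v₀))
      ... | no  u≉v₀ | no  v≉v₀ | inj₁ u≈v₀ = u≉v₀ u≈v₀
      ... | no  u≉v₀ | no  v≉v₀ | inj₂ near = v≉v₀ (near v u∼v)

    -- The diameter is at most two, so nonadjacency coincides with `≈`, and the classes are the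
    -- parts.
    triangles⇒completeMultipartite : (∀ {x y} → x ∼ y → ∃[ t ] (x ∼ t × t ∼ y)) → CompleteMultipartite G
    triangles⇒completeMultipartite triangle = _ , part , λ u v → mk⇔ differ adjacent
      where
      -- Adjacent vertices are included, since an edge in a triangle has its ends joined by a walk
      -- of length two.
      Near : Fin n → Fin n → Set
      Near x z = x ≡ z ⊎ Walk G 2 x z

      -- If x ∼ y ∼ z ∼ w has no shortcut of length at most two from x to w, then
      -- x ≈ z and y ≈ w, so a common neighbour of y and z is adjacent to both
      -- x and w.
      near-closed : ∀ x → Closed (Near x)
      near-closed x {z} {w} z∼w (inj₁ ≡.refl) = let t , z∼t , t∼w = triangle z∼w in
        inj₂ (t , z∼t , w , t∼w , ≡.refl)
      near-closed x {z} {w} z∼w (inj₂ (y , x∼y , _ , y∼z , ≡.refl)) with x ∼? z | y ∼? w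
      ... | yes x∼z | _       = inj₂ (z , x∼z , w , z∼w , ≡.refl)
      ... | no  _   | yes y∼w = inj₂ (y , x∼y , w , y∼w , ≡.refl)
      ... | no  x≁z | no  y≁w = let t , y∼t , t∼z = triangle y∼z in inj₂ (t ,
        decidable-stable (x ∼? t) (λ x≁t →
          edge⇒≉ t∼z (trans (sym (twoStep x∼y y∼t x≁t)) (twoStep x∼y y∼z x≁z))) ,
        w ,
        decidable-stable (t ∼? w) (λ t≁w →
          edge⇒≉ y∼t (trans (twoStep y∼z z∼w y≁w) (sym (twoStep t∼z z∼w t≁w)))) ,
        ≡.refl)

      near : ∀ x z → Near x z
      near x = spread connected (λ z → (x Fin.≟ z) ⊎-dec walk? G 2 x z) (near-closed x) (inj₁ ≡.refl)

      nonadjacent⇒≈ : ∀ {x z} → ¬ (x ∼ z) → x ≈ z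
      nonadjacent⇒≈ {x} {z} x≁z with near x z
      ... | inj₁ ≡.refl                     = refl
      ... | inj₂ (y , x∼y , _ , y∼z , ≡.refl) = twoStep x∼y y∼z x≁z

      neighbour : Fin n → Fin n → Fin 2
      neighbour u w = if does (u ∼? w) then suc zero else zero

      -- The part of a vertex is named by its set of neighbours.
      part : Fin n → Fin (2 ℕ.^ n)
      part u = funToFin (neighbour u)

      differ : ∀ {u v} → u ∼ v → part u ≢ part v
      differ {u} {v} u∼v pu≡pv = contradiction (begin
        suc zero                   ≡⟨ ≡.cong (λ b → if b then suc zero else zero) (dec-true (u ∼? v) u∼v) ⟨
        neighbour u v              ≡⟨ finToFun-funToFin (neighbour u) v ⟨
        finToFun (part u) v        ≡⟨ ≡.cong (λ p → finToFun p v) pu≡pv ⟩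
        finToFun (part v) v        ≡⟨ finToFun-funToFin (neighbour v) v ⟩
        neighbour v v              ≡⟨ ≡.cong (λ b → if b then suc zero else zero) (dec-false (v ∼? v) (∼-irrefl ≡.refl)) ⟩
        zero                       ∎) λ ()
        where open ≡.≡-Reasoning

      -- If `v` were not adjacent to `w`, then `u`, `v` and `w` would be equivalent, against the
      -- edge from `u` to `w`.
      transfer : ∀ {u v w} → u ≈ v → u ∼ w → v ∼ w
      transfer {u} {v} {w} u≈v u∼w = decidable-stable (v ∼? w) (λ v≁w →
        edge⇒≉ u∼w (trans u≈v (nonadjacent⇒≈ v≁w)))

      adjacent : ∀ {u v} → part u ≢ part v → u ∼ v
      adjacent {u} {v} pu≢pv = decidable-stable (u ∼? v) (λ u≁v →
        pu≢pv (funToFin-cong (λ w → ≡.cong (λ b → if b then suc zero else zero)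
          (does-⇔ (mk⇔ (transfer (nonadjacent⇒≈ u≁v)) (transfer (sym (nonadjacent⇒≈ u≁v)))) (u ∼? w) (v ∼? w)))))

  -- The idempotent power of `φ` is an endomorphism, hence the identity. The power with one factor
  -- less is then an inverse of `φ`, and being an endomorphism it carries edges back.
  idempotentsTrivial⇒core : (∀ ψ → IsEndomorphism G ψ → (∀ x → ψ (ψ x) ≡ ψ x) → ∀ x → ψ x ≡ x) → Core G
  idempotentsTrivial⇒core trivial φ φ-endo =
    ((λ {x} {y} φx≡φy → ≡.trans (≡.sym (inverseˡ x)) (≡.trans (≡.cong φ⁻¹ φx≡φy) (inverseˡ y))) ,
     λ y → φ⁻¹ y , λ { ≡.refl → inverseʳ y }) ,
    λ u v → mk⇔ φ-endo (λ φu∼φv → ≡.subst₂ _∼_ (inverseˡ u) (inverseˡ v) (iterate-endo m φu∼φv))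
    where
    iterate-endo : ∀ k → IsEndomorphism G (iterate φ k)
    iterate-endo zero    u∼v = u∼v
    iterate-endo (suc k) u∼v = φ-endo (iterate-endo k u∼v)

    m : ℕ
    m = ℕ.pred (exponent φ)

    φ⁻¹ : Fin n → Fin n
    φ⁻¹ = iterate φ m

    inverseʳ : ∀ x → φ (φ⁻¹ x) ≡ x
    inverseʳ x = ≡.trans
      (≡.cong (λ k → iterate φ k x) (ℕ.suc-pred (exponent φ) {{ℕ.m*n≢0 (suc n) (n !) {{_}} {{n ℕ.!≢0}}}}))
      (trivial (iterate φ (exponent φ)) (iterate-endo (exponent φ)) (iterate-exponent-idempotent φ) x)

    inverseˡ : ∀ x → φ⁻¹ (φ x) ≡ x
    inverseˡ x = ≡.trans (≡.sym (iterate-+ φ m 1 x))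
      (≡.trans (≡.cong (λ k → iterate φ k x) (ℕ.+-comm m 1)) (inverseʳ x))

-- Consequences of unique vector colorability

module UniqueColoring {c ℓ₁ ℓ₂ : Level} (ℝ : CompleteOrderedField c ℓ₁ ℓ₂) {n : ℕ} (G : Graph n)
  (unique : UniquelyVectorColorable ℝ G) (optimal : CanonicalColoring.OptimalColoring ℝ G) where
  open OrderedField ℝ
  open InnerProducts ℝ
  open CanonicalColoring ℝ G using (A; A-adjacent; A-nonNegative; A²≈; walkRegular-edges; module OptimalColoring)
  open OptimalColoring optimal
  open IsVectorColoring isVectorColoring
  open Graph G
  open ≈-Reasoning

  private
    d : ℕ
    d = dimension

  module _ (R : Vector Carrier d → Vector Carrier d) (isometry : ∀ x y → ⟪ R x , R y ⟫ ≈ ⟪ x , y ⟫)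
           (S : Fin n → Bool) (S-closed : ∀ {u v} → u ∼ v → S u ≡ S v) where

    move : Bool → Vector Carrier d → Vector Carrier d
    move true  = R
    move false = id

    move-isometry : ∀ b x y → ⟪ move b x , move b y ⟫ ≈ ⟪ x , y ⟫
    move-isometry true  x y = isometry x y
    move-isometry false x y = refl

    -- No edge leaves `S`, so both ends of an edge are moved alike.
    moved-isVectorColoring : IsVectorColoring ℝ G t (λ i → move (S i) (p i))
    moved-isVectorColoring = record
      { unit = λ i → trans (move-isometry (S i) (p i) (p i)) (unit i)
      ; edge = λ i j i∼j → ≤-respˡ-≈
          (trans (sym (move-isometry (S i) (p i) (p j)))
            (reflexive (≡.cong (λ b → ⟪ move (S i) (p i) , move b (p j) ⟫) (S-closed i∼j))))
          (edge i j i∼j)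
      }

    isometry-invisible : ∀ {x y} → S x ≡ true → S y ≡ false → ⟪ R (p x) , p y ⟫ ≈ ⟪ p x , p y ⟫
    isometry-invisible {x} {y} Sx Sy = begin
      ⟪ R (p x) , p y ⟫                          ≡⟨ ≡.cong₂ (λ a b → ⟪ move a (p x) , move b (p y) ⟫) Sx Sy ⟨
      ⟪ move (S x) (p x) , move (S y) (p y) ⟫    ≈⟨ unique chromaticNumber isVectorColoring moved-isVectorColoring x y ⟨
      ⟪ p x , p y ⟫                              ∎

  -- The reflection in the hyperplane orthogonal to `w`, in the form valid for squared norm two.
  reflection : Vector Carrier d → Vector Carrier d → Vector Carrier d
  reflection w x k = x k + - ⟪ x , w ⟫ * w k

  reflection-isometry : ∀ w → ⟪ w , w ⟫ ≈ 1# + 1# → ∀ x y → ⟪ reflection w x , reflection w y ⟫ ≈ ⟪ x , y ⟫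
  reflection-isometry w ww≈2 x y = begin
    ⟪ reflection w x , reflection w y ⟫
      ≈⟨ ⟪⟫-+*ˡ x a w (reflection w y) ⟩
    ⟪ x , reflection w y ⟫ + a * ⟪ w , reflection w y ⟫
      ≈⟨ +-cong (⟪⟫-+*ʳ x y b w) (*-congˡ (⟪⟫-+*ʳ w y b w)) ⟩
    (⟪ x , y ⟫ + b * ⟪ x , w ⟫) + a * (⟪ w , y ⟫ + b * ⟪ w , w ⟫)
      ≈⟨ +-congˡ (*-congˡ (+-cong (⟪⟫-comm w y) (*-congˡ ww≈2))) ⟩
    (⟪ x , y ⟫ + b * ⟪ x , w ⟫) + a * (⟪ y , w ⟫ + b * (1# + 1#))
      ≈⟨ solve 3 (λ z x y → (z :+ (:- y) :* x) :+ (:- x) :* (y :+ (:- y) :* (:1 :+ :1)) := z) refl ⟪ x , y ⟫ ⟪ x , w ⟫ ⟪ y , w ⟫ ⟩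
    ⟪ x , y ⟫ ∎
    where
    a b : Carrier
    a = - ⟪ x , w ⟫
    b = - ⟪ y , w ⟫

  -- Moving one union of components by an isometry gives another optimal
  -- coloring.  Negation shows that p x ⊥ p y across components, and then the
  -- reflection that exchanges p x and p y gives a contradiction.
  noSeparation : (S : Fin n → Bool) → (∀ {u v} → u ∼ v → S u ≡ S v) → ∀ {x y} → S x ≡ true → ¬ (S y ≡ false)
  noSeparation S S-closed {x} {y} Sx Sy = 1≉0 (begin
    1#
      ≈⟨ solve 0 (:1 := :0 :+ (:- (:1 :+ (:- :1) :* :0)) :* (:0 :+ (:- :1) :* :1)) refl ⟩
    0# + - (1# + - 1# * 0#) * (0# + - 1# * 1#)
      ≈⟨ +-cong orthogonal (*-cong (-‿cong (trans (⟪⟫-+*ʳ (p x) (p x) (- 1#) (p y)) (+-cong (unit x) (*-congˡ orthogonal))))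
           (trans (⟪⟫-+*ˡ (p x) (- 1#) (p y) (p y)) (+-cong orthogonal (*-congˡ (unit y))))) ⟨
    ⟪ p x , p y ⟫ + - ⟪ p x , w ⟫ * ⟪ w , p y ⟫
      ≈⟨ ⟪⟫-+*ˡ (p x) (- ⟪ p x , w ⟫) w (p y) ⟨
    ⟪ reflection w (p x) , p y ⟫
      ≈⟨ isometry-invisible (reflection w) (reflection-isometry w ww≈2) S S-closed Sx Sy ⟩
    ⟪ p x , p y ⟫
      ≈⟨ orthogonal ⟩
    0# ∎)
    where
    negate : Vector Carrier d → Vector Carrier d
    negate x k = - 1# * x k

    negate-isometry : ∀ x y → ⟪ negate x , negate y ⟫ ≈ ⟪ x , y ⟫
    negate-isometry x y = sum-cong-≋ (λ k →
      solve 2 (λ x y → ((:- :1) :* x) :* ((:- :1) :* y) := x :* y) refl (x k) (y k))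

    orthogonal : ⟪ p x , p y ⟫ ≈ 0#
    orthogonal = x*y≈0⇒y≈0 (1≤x⇒x≉0 (≤-respˡ-≈ (+-identityʳ 1#) (+-mono-≤ ≤-refl 0≤1))) (begin
      (1# + 1#) * a                   ≈⟨ solve 1 (λ a → (:1 :+ :1) :* a := a :- (:- :1) :* a) refl a ⟩
      a - - 1# * a                    ≈⟨ +-congˡ (-‿cong (*-congˡ (⟪⟫-comm (p x) (p y)))) ⟩
      a - - 1# * ⟪ p y , p x ⟫        ≈⟨ +-congˡ (-‿cong (trans (⟪⟫-comm (negate (p x)) (p y)) (⟪⟫-*ʳ (p y) (- 1#) (p x)))) ⟨
      a - ⟪ negate (p x) , p y ⟫      ≈⟨ +-congˡ (-‿cong (isometry-invisible negate negate-isometry S S-closed Sx Sy)) ⟩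
      a - a                           ≈⟨ -‿inverseʳ a ⟩
      0#                              ∎)
      where a = ⟪ p x , p y ⟫

    w : Vector Carrier d
    w k = p x k + - 1# * p y k

    ww≈2 : ⟪ w , w ⟫ ≈ 1# + 1#
    ww≈2 = begin
      ⟪ w , w ⟫
        ≈⟨ norm²-+* (p x) (- 1#) (p y) ⟩
      ⟪ p x , p x ⟫ + - 1# * (⟪ p x , p y ⟫ + ⟪ p x , p y ⟫) + - 1# * - 1# * ⟪ p y , p y ⟫
        ≈⟨ +-cong (+-cong (unit x) (*-congˡ (+-cong orthogonal orthogonal))) (*-congˡ (unit y)) ⟩
      1# + - 1# * (0# + 0#) + - 1# * - 1# * 1#
        ≈⟨ solve 0 (:1 :+ (:- :1) :* (:0 :+ :0) :+ (:- :1) :* (:- :1) :* :1 := :1 :+ :1) refl ⟩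
      1# + 1# ∎

  connected : Connected G
  connected S S-closed u v = byCases (S u) (S v) ≡.refl ≡.refl
    where
    byCases : ∀ a b → S u ≡ a → S v ≡ b → S u ≡ S v
    byCases true  true  Su Sv = ≡.trans Su (≡.sym Sv)
    byCases false false Su Sv = ≡.trans Su (≡.sym Sv)
    byCases true  false Su Sv = contradiction Sv (noSeparation S S-closed Su)
    byCases false true  Su Sv = contradiction Su (noSeparation S S-closed Sv)

  -- `p ∘ ψ` is again a coloring with the optimal value `t`, so uniqueness applies to it.
  endomorphism-preservesGram : ∀ {ψ} → IsEndomorphism G ψ → ∀ u v → ⟪ p (ψ u) , p (ψ v) ⟫ ≈ ⟪ p u , p v ⟫
  endomorphism-preservesGram {ψ} ψ-endo u v = sym (unique chromaticNumber {q = p ∘ ψ} isVectorColoring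
    (record { unit = λ i → unit (ψ i) ; edge = λ i j i∼j → edge (ψ i) (ψ j) (ψ-endo i∼j) }) u v)

  _≅_ : Rel (Fin n) ℓ₁
  u ≅ v = ∀ k → p u k ≈ p v k

  ≅-isDecEquivalence : IsDecEquivalence _≅_
  ≅-isDecEquivalence = record
    { isEquivalence = record
      { refl  = λ k → refl
      ; sym   = λ u≅v k → sym (u≅v k)
      ; trans = λ u≅v v≅w k → trans (u≅v k) (v≅w k)
      }
    ; _≟_ = λ u v → all? (λ k → p u k ≟ p v k)
    }

  -- Equal unit vectors have inner product one, but on an edge the bound `- ((t - 1#) ⁻¹)` is at
  -- most zero, as `t` is at least two.
  edge⇒≇ : ∀ {u v} → u ∼ v → ¬ (u ≅ v)
  edge⇒≇ {u} {v} u∼v u≅v = 1≤x⇒x≉0 1≤t-1 (begin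
    t - 1#              ≈⟨ *-identityʳ _ ⟨
    (t - 1#) * 1#       ≈⟨ *-congˡ 1≈0 ⟩
    (t - 1#) * 0#       ≈⟨ zeroʳ _ ⟩
    0#                  ∎)
    where
    1≤t-1 : 1# ≤ t - 1#
    1≤t-1 = 0≤y-x⇒x≤y (≤-respʳ-≈ (solve 1 (λ t → t :- (:1 :+ :1) := (t :- :1) :- :1) refl t)
      (x≤y⇒0≤y-x (proj₁ (proj₁ chromaticNumber))))
    1≤-r : 1# ≤ - ((t - 1#) ⁻¹)
    1≤-r = ≤-respˡ-≈ (trans (⟪⟫-congˡ {x = p u} (λ k → sym (u≅v k))) (unit u)) (edge u v u∼v)
    1≈0 : 1# ≈ 0#
    1≈0 = ≤-antisym (≤-trans 1≤-r (≤-respʳ-≈ (solve 0 (:- :0 := :0) refl)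
      (-‿antimono-≤ (⁻¹-nonNegative (≤-trans 0≤1 1≤t-1) (1≤x⇒x≉0 1≤t-1))))) 0≤1

  nonadjacent⇒distance2 : ∀ {x y z} → x ∼ y → y ∼ z → ¬ (x ∼ z) → x ≢ z → Distance G 2 x z
  nonadjacent⇒distance2 {x} {y} {z} x∼y y∼z x≁z x≢z = (y , x∼y , z , y∼z , ≡.refl) ,
    λ { {zero} _ x≡z → x≢z x≡z
      ; {suc zero} _ (_ , x∼z , ≡.refl) → x≁z x∼z
      ; {suc (suc _)} (ℕ.s≤s (ℕ.s≤s ())) }

  -- All pairs at distance two have the same inner product, so if one of them
  -- is identified, then all of them are.
  twoStep : ∀ {u w} → Distance G 2 u w → ⟪ p u , p w ⟫ ≈ 1# →
            ∀ {x y z} → x ∼ y → y ∼ z → ¬ (x ∼ z) → x ≅ z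
  twoStep {u} {w} uw uw≈1 {x} {y} {z} x∼y y∼z x≁z = byCases (x Fin.≟ z)
    where
    byCases : Dec (x ≡ z) → x ≅ z
    byCases (yes ≡.refl) k = refl
    byCases (no x≢z) = unit-⟪⟫≈1⇒≈ (p x) (p z) (unit x) (unit z)
      (trans (proj₂ constantDistance2 (nonadjacent⇒distance2 x∼y y∼z x≁z x≢z))
        (trans (sym (proj₂ constantDistance2 uw)) uw≈1))

  -- The entry of the squared adjacency matrix at an edge counts the common neighbours of its ends.
  -- It is the same for all edges, and a single triangle makes it nonzero.
  triangleOnEdge : OneWalkRegular ℝ G → ∀ {x y z} → x ∼ y → y ∼ z → x ∼ z →
                   ∀ {u v} → u ∼ v → ∃[ t ] (u ∼ t × t ∼ v)
  triangleOnEdge reg {x} {y} {z} x∼y y∼z x∼z {u} {v} u∼v =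
    decidable-stable (any? (λ t → (u ∼? t) ×-dec (t ∼? v))) (λ none →
      1≉0 (begin
        1#             ≈⟨ *-identityˡ 1# ⟨
        1# * 1#        ≈⟨ *-cong (A-adjacent x∼y) (A-adjacent (∼-sym y∼z)) ⟨
        A x y * A z y  ≈⟨ sum≈0⇒term≈0 (λ t → *-nonNegative (A-nonNegative x t) (A-nonNegative z t)) (begin
          ⟪ A x , A z ⟫    ≈⟨ A²≈ x z ⟨
          (_^_ ℝ A 2) x z  ≈⟨ A²≈b x∼z ⟩
          _                ≈⟨ A²≈b u∼v ⟨
          (_^_ ℝ A 2) u v  ≈⟨ A²≈ u v ⟩
          ⟪ A u , A v ⟫    ≈⟨ sum-zero (λ t → noTriangle none t) ⟩
          0#               ∎) y ⟩
        0#             ∎))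
    where
    A²≈b = proj₂ (walkRegular-edges reg 2)
    noTriangle : ¬ (∃[ t ] (u ∼ t × t ∼ v)) → ∀ t → A u t * A v t ≈ 0#
    noTriangle none t = byCases (u ∼? t) (v ∼? t)
      where
      open CanonicalColoring ℝ G using (A-nonadjacent)
      byCases : Dec (u ∼ t) → Dec (v ∼ t) → A u t * A v t ≈ 0#
      byCases (yes u∼t) (yes v∼t) = contradiction (t , u∼t , ∼-sym v∼t) none
      byCases (no u≁t)  _         = trans (*-congʳ (A-nonadjacent u≁t)) (zeroˡ (A v t))
      byCases (yes _)   (no v≁t)  = trans (*-congˡ (A-nonadjacent v≁t)) (zeroʳ (A u t))

  module _ (reg : OneWalkRegular ℝ G) (¬bipartite : ¬ Bipartite G) (¬multipartite : ¬ CompleteMultipartite G) where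

    -- Otherwise `twoStep` makes `TwoStepRelation` applicable, and one of the two excluded shapes
    -- results, according to whether a triangle exists.
    distance2⇒distinct : ∀ {u w} → Distance G 2 u w → ¬ (⟪ p u , p w ⟫ ≈ 1#)
    distance2⇒distinct {u} uw uw≈1 =
      byCases (any? (λ x → any? (λ y → any? (λ z → (x ∼? y) ×-dec ((y ∼? z) ×-dec (x ∼? z))))))
      where
      open TwoStepRelation G connected ≅-isDecEquivalence edge⇒≇ (twoStep uw uw≈1)
      byCases : ¬ Dec (∃[ x ] ∃[ y ] ∃[ z ] (x ∼ y × y ∼ z × x ∼ z))
      byCases (yes (x , y , z , x∼y , y∼z , x∼z)) =
        ¬multipartite (triangles⇒completeMultipartite (triangleOnEdge reg x∼y y∼z x∼z))
      byCases (no triangleFree) = ¬bipartite (triangleFree⇒bipartite u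
        (λ x∼y y∼z x∼z → triangleFree (_ , _ , _ , x∼y , y∼z , x∼z)))

    -- If v is fixed and w is adjacent to v, then ψ w and w have the common
    -- neighbour v and the common image ψ w.
    idempotent-trivial : ∀ ψ → IsEndomorphism G ψ → (∀ x → ψ (ψ x) ≡ ψ x) → ∀ x → ψ x ≡ x
    idempotent-trivial ψ ψ-endo idem x = spread G connected (λ v → ψ v Fin.≟ v) fixed-closed (idem x) x
      where
      fixed-closed : Closed G (λ v → ψ v ≡ v)
      fixed-closed {v} {w} v∼w ψv≡v = decidable-stable (ψ w Fin.≟ w) (λ ψw≢w →
        distance2⇒distinct
          (nonadjacent⇒distance2 (∼-sym (≡.subst (_∼ ψ w) ψv≡v (ψ-endo v∼w))) v∼w
            (λ ψw∼w → ∼-irrefl (idem w) (ψ-endo ψw∼w)) ψw≢w)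
          (begin
            ⟪ p (ψ w) , p w ⟫              ≈⟨ endomorphism-preservesGram ψ-endo (ψ w) w ⟨
            ⟪ p (ψ (ψ w)) , p (ψ w) ⟫      ≡⟨ ≡.cong (λ v → ⟪ p v , p (ψ w) ⟫) (idem w) ⟩
            ⟪ p (ψ w) , p (ψ w) ⟫          ≈⟨ unit (ψ w) ⟩
            1#                             ∎))

    core : Core G
    core = idempotentsTrivial⇒core G idempotent-trivial

theorem4p11 : ∀ {c ℓ₁ ℓ₂ : Level} (ℝ : CompleteOrderedField c ℓ₁ ℓ₂) {n : ℕ} (G : Graph n) →
    TwoWalkRegular ℝ G →
    ¬ Bipartite G →
    ¬ CompleteMultipartite G →
    UniquelyVectorColorable ℝ G →
    Core G
theorem4p11 ℝ G reg ¬bipartite ¬multipartite unique = byCases (any? (λ i → any? (λ j → i ∼? j)))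
  where
  open Graph G
  byCases : Dec (∃[ i ] ∃[ j ] (i ∼ j)) → Core G
  byCases (yes (i , j , i∼j)) = UniqueColoring.core ℝ G unique
    (CanonicalColoring.optimalColoring ℝ G reg i∼j) (proj₁ reg) ¬bipartite ¬multipartite
  -- Without edges a constant map is a proper coloring, so the graph is bipartite.
  byCases (no edgeless) = contradiction ((λ _ → zero) , λ u v u∼v → contradiction (u , v , u∼v) edgeless) ¬bipartite
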